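{- Let $M$ be the weighted adjacency matrix of a finite simple loopless graph $G$ on $n$ vertices with edge weights $\operatorname{wg}(e)\in\mathbb{Z}[w,r]$, let $X=\operatorname{diag}(x_1,\ldots,x_n)$ with $x_1,\dots,x_n$ commuting indeterminates, and let $C_k(M)$ be the total weight of the unoriented simple $k$-cycles of $G$. Then $$\operatorname{sq}\Bigl(-\log\det\bigl(I-tXM\bigr)\Bigr)=\Bigl(\sum_{e\in E(G)}\operatorname{wg}(e)^2\Bigr)t^2+2\sum_{k\ge3}C_k(M)\,t^k .$$ In particular the coefficient of $t^1$ vanishes, and the right-hand side is a polynomial in $t$ of degree at most $n$.
   Context: The weighted adjacency matrix $M=(m_{ij})$ of $G$ (vertices $v_1,\ldots,v_n$) is the symmetric matrix with $m_{ij}=\operatorname{wg}(e)$ if $v_i,v_j$ are joined by an edge $e$, and $m_{ij}=0$ otherwise. The weight of a cycle $C$ is $\prod_{e\in E(C)}\operatorname{wg}(e)$, and $C_k(M)$ is the sum of the weights of all unoriented simple cycles of length $k$ in $G$. The logarithm is the formal one, $\log(1+u)=\sum_{j\ge1}(-1)^{j+1}u^j/j$; since $\det(I-tXM)\in1+t\,\mathbb{Z}[w,r][x_1,\ldots,x_n][t]$, the series $-\log\det(I-tXM)$ is a well-defined element of $t\,\mathbb{Q}[w,r][x_1,\ldots,x_n][[t]]$. For $P=\sum_\alpha c_\alpha x^\alpha\in\mathbb{Q}[w,r][x_1,\ldots,x_n]$, $\operatorname{sq}(P)=\sum_{\alpha\in\{0,1\}^n}c_\alpha$ is the sum of the coefficients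 of the squarefree (multilinear) monomials; it is extended coefficientwise to power series in $t$: $\operatorname{sq}(\sum_kP_kt^k)=\sum_k\operatorname{sq}(P_k)t^k$. -}

module Defs where

open import Algebra.Bundles.Raw using (RawRing)
import Algebra.Definitions.RawSemiring as RawSemiringDefs
open import Data.Bool.Base using (if_then_else_)
open import Data.Fin.Base using (Fin; zero; suc; toℕ; punchIn)
import Data.Fin.Base as Fin
import Data.Fin.Properties as Fin
open import Data.Integer.Base using (-1ℤ)
import Data.Integer.Base as ℤ
open import Data.List.Base as List using (List; []; _∷_; _++_; allFin; cartesianProduct;
  cartesianProductWith; deduplicate; filter; iterate)
open import Data.List.Membership.Propositional using (_∈_)
import Data.List.Membership.DecPropositional as DecMembership
open import Data.Nat.Base using (ℕ; zero; suc; _∸_; _≤_; _<_; NonZero)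
import Data.Nat.Properties as ℕ
open import Data.Product.Base using (_×_; _,_; uncurry)
open import Data.Rational.Base using (ℚ; _/_)
import Data.Rational.Base as ℚ
open import Data.Vec.Base as Vec using (Vec; []; _∷_; _∷ʳ_)
import Data.Vec.Properties as Vec
open import Data.Vec.Relation.Unary.All as All using (All)
open import Data.Vec.Relation.Unary.AllPairs as AllPairs using ()
open import Data.Vec.Relation.Unary.Unique.Propositional using (Unique)
open import Level using (Level; 0ℓ)
open import Relation.Binary.Core using (Rel)
open import Relation.Binary.Definitions using (Decidable; Symmetric; Irreflexive)
open import Relation.Binary.PropositionalEquality.Core using (_≡_)
open import Relation.Nullary.Decidable using (Dec; does; _×-dec_; ¬?)

private variable
  c ℓ c′ ℓ′ : Level
  n k : ℕ

∣_∣ : RawRing c ℓ → Set c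
∣ R ∣ = RawRing.Carrier R

module _ (R : RawRing c ℓ) where
  open RawRing R
  open RawSemiringDefs rawSemiring using (sum; _^_)

  listSum : {A : Set} → List A → (A → Carrier) → Carrier
  listSum xs f = List.foldr (λ a s → f a + s) 0# xs

  Matrix : ℕ → Set c
  Matrix n = Fin n → Fin n → Carrier

  diag : (Fin n → Carrier) → Matrix n
  diag d i j = if does (i Fin.≟ j) then d i else 0#

  identity : Matrix n
  identity = diag (λ _ → 1#)

  _⊗_ : Matrix n → Matrix n → Matrix n
  (A ⊗ B) i j = sum (λ l → A i l * B l j)

  _⊝_ : Matrix n → Matrix n → Matrix n
  (A ⊝ B) i j = A i j + - B i j

  _⊙_ : Carrier → Matrix n → Matrix n
  (a ⊙ A) i j = a * A i j

  -- Laplace expansion along the first row.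
  det : Matrix n → Carrier
  det {zero}  A = 1#
  det {suc n} A = sum λ j →
    (- 1#) ^ toℕ j * (A zero j * det (λ i l → A (suc i) (punchIn j l)))

  -- Univariate polynomials: lists of coefficients, constant term first.
  -- Trailing zeros are allowed, so equality compares coefficients.
  coeff : List Carrier → ℕ → Carrier
  coeff []      k       = 0#
  coeff (a ∷ p) zero    = a
  coeff (a ∷ p) (suc k) = coeff p k

  infixl 6 _+ₚ_
  _+ₚ_ : List Carrier → List Carrier → List Carrier
  []      +ₚ q       = q
  (a ∷ p) +ₚ []      = a ∷ p
  (a ∷ p) +ₚ (b ∷ q) = (a + b) ∷ (p +ₚ q)

  infixl 7 _*ₚ_
  _*ₚ_ : List Carrier → List Carrier → List Carrier
  []      *ₚ q = []
  (a ∷ p) *ₚ q = List.map (a *_) q +ₚ (0# ∷ (p *ₚ q))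

  Poly : RawRing c ℓ
  Poly = record
    { Carrier = List Carrier
    ; _≈_     = λ p q → ∀ k → coeff p k ≈ coeff q k
    ; _+_     = _+ₚ_
    ; _*_     = _*ₚ_
    ; -_      = List.map (-_)
    ; 0#      = []
    ; 1#      = 1# ∷ []
    }

  infix 9 _⟦t⟧
  _⟦t⟧ : RawRing c ℓ
  _⟦t⟧ = record
    { Carrier = ℕ → Carrier
    ; _≈_     = λ f g → ∀ k → f k ≈ g k
    ; _+_     = λ f g k → f k + g k
    ; _*_     = λ f g k → sum {suc k} (λ i → f (toℕ i) * g (k ∸ toℕ i))
    ; -_      = λ f k → - f k
    ; 0#      = λ _ → 0#
    ; 1#      = λ { zero → 1# ; (suc _) → 0# }
    }

  constₜ : Carrier → ∣ _⟦t⟧ ∣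
  constₜ a zero    = a
  constₜ a (suc _) = 0#

  t : ∣ _⟦t⟧ ∣
  t 1 = 1#
  t _ = 0#

  DegreeAtMost : ℕ → ∣ _⟦t⟧ ∣ → Set ℓ
  DegreeAtMost d f = ∀ k → d < k → f k ≈ 0#

-- R [X^ n ] is R[x₁,…,xₙ], with x₁ the outermost variable.
infix 9 _[X^_]
_[X^_] : RawRing c ℓ → ℕ → RawRing c ℓ
R [X^ zero  ] = R
R [X^ suc n ] = Poly (R [X^ n ])

const : (R : RawRing c ℓ) (n : ℕ) → ∣ R ∣ → ∣ R [X^ n ] ∣
const R zero    a = a
const R (suc n) a = const R n a ∷ []

var : (R : RawRing c ℓ) → Fin n → ∣ R [X^ n ] ∣
var {n = suc n} R zero    = RawRing.0# (R [X^ n ]) ∷ RawRing.1# (R [X^ n ]) ∷ []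
var {n = suc n} R (suc i) = var R i ∷ []

coeffAt : (R : RawRing c ℓ) → ∣ R [X^ n ] ∣ → Vec ℕ n → ∣ R ∣
coeffAt R p []                  = p
coeffAt {n = suc n} R p (a ∷ α) = coeffAt R (coeff (R [X^ n ]) p a) α

mapCoeffs : (R : RawRing c ℓ) (S : RawRing c′ ℓ′) (n : ℕ) →
            (∣ R ∣ → ∣ S ∣) → ∣ R [X^ n ] ∣ → ∣ S [X^ n ] ∣
mapCoeffs R S zero    f = f
mapCoeffs R S (suc n) f = List.map (mapCoeffs R S n f)

vecsOver : {A : Set} → List A → (k : ℕ) → List (Vec A k)
vecsOver as zero    = [] ∷ []
vecsOver as (suc k) = cartesianProductWith _∷_ as (vecsOver as k)

sq : (R : RawRing c ℓ) → ∣ R [X^ n ] ∣ → ∣ R ∣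
sq {n = n} R p = listSum R (vecsOver (0 ∷ 1 ∷ []) n) (coeffAt R p)

-- With u = F - 1, the coefficient of tᵏ in Σ_{j≥1} (-1)^{j+1} uʲ / j.
-- For F ∈ 1 + t A⟦t⟧, the only case in which this is meant to be used,
-- uʲ ∈ tʲ A⟦t⟧, so the terms with j > k do not contribute.
-- The argument ρ is the structure map of the ℚ-algebra A.
log : (A : RawRing c ℓ) (ρ : ℚ → ∣ A ∣) → ∣ A ⟦t⟧ ∣ → ∣ A ⟦t⟧ ∣
log A ρ F k = sum {k} (λ i → term (suc (toℕ i)))
  where
  open RawRing A using (Carrier; _*_; rawSemiring)
  open RawSemiringDefs rawSemiring using (sum)
  open RawRing (A ⟦t⟧) using (_+_; -_; 1#)
  open RawSemiringDefs (RawRing.rawSemiring (A ⟦t⟧)) using (_^_)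
  u : ∣ A ⟦t⟧ ∣
  u = F + - 1#
  term : (j : ℕ) .{{_ : NonZero j}} → Carrier
  term j = ρ ((-1ℤ ℤ.^ suc j) / j) * (u ^ j) k

record SimpleGraph (n : ℕ) : Set₁ where
  infix 4 _~_ _~?_
  field
    _~_      : Rel (Fin n) 0ℓ
    _~?_     : Decidable _~_
    ~-sym    : Symmetric _~_
    ~-irrefl : Irreflexive _≡_ _~_

-- The weight of the edge {i , j} is wg i j; the values of wg at
-- non-adjacent pairs are never used.
record EdgeWeights (R : RawRing c ℓ) (G : SimpleGraph n) : Set (c Level.⊔ ℓ) where
  open RawRing R using (Carrier; _≈_)
  open SimpleGraph G
  field
    wg     : Fin n → Fin n → Carrier
    wg-sym : ∀ {i j} → i ~ j → wg i j ≈ wg j i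

rotate : {A : Set} → Vec A k → Vec A k
rotate []       = []
rotate (v ∷ vs) = vs ∷ʳ v

-- The pairs (v₁,v₂), (v₂,v₃), …, (vₖ,v₁).
steps : {A : Set} → Vec A k → Vec (A × A) k
steps c = Vec.zip c (rotate c)

dihedralOrbit : {A : Set} → Vec A k → List (Vec A k)
dihedralOrbit {k = k} c = iterate rotate c k ++ iterate rotate (Vec.reverse c) k

-- Two vertex sequences describe the same unoriented cycle when they differ
-- by the choice of the starting point and of the direction.
SameCycle : {A : Set} → Rel (Vec A k) 0ℓ
SameCycle c d = d ∈ dihedralOrbit c

sameCycle? : Decidable (SameCycle {k} {Fin n})
sameCycle? c d = DecMembership._∈?_ (Vec.≡-dec Fin._≟_) d (dihedralOrbit c)

module _ (G : SimpleGraph n) where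
  open SimpleGraph G

  edges : List (Fin n × Fin n)
  edges = filter (λ (i , j) → (i Fin.<? j) ×-dec (i ~? j))
                 (cartesianProduct (allFin n) (allFin n))

  IsCycle : Vec (Fin n) k → Set
  IsCycle {k} c = 3 ≤ k × Unique c × All (uncurry _~_) (steps c)

  isCycle? : (c : Vec (Fin n) k) → Dec (IsCycle c)
  isCycle? {k} c = (3 ℕ.≤? k)
             ×-dec AllPairs.allPairs? (λ i j → ¬? (i Fin.≟ j)) c
             ×-dec All.all? (uncurry _~?_) (steps c)

  -- One vertex sequence for each unoriented simple k-cycle of G.
  cycles : (k : ℕ) → List (Vec (Fin n) k)
  cycles k = deduplicate sameCycle? (filter isCycle? (vecsOver (allFin n) k))

module _ (R : RawRing c ℓ) {G : SimpleGraph n} (W : EdgeWeights R G) where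
  open RawRing R
  open SimpleGraph G
  open EdgeWeights W

  adjacency : Matrix R n
  adjacency i j = if does (i ~? j) then wg i j else 0#

  cycleWeight : Vec (Fin n) k → Carrier
  cycleWeight c = Vec.foldr′ _*_ 1# (Vec.map (uncurry wg) (steps c))

  cycleSum : ℕ → Carrier
  cycleSum k = listSum R (cycles G k) cycleWeight

  -- (Σₑ wg(e)²) t² + 2 Σ_{k≥3} Cₖ tᵏ
  edgeCycleSeries : ∣ R ⟦t⟧ ∣
  edgeCycleSeries 0 = 0#
  edgeCycleSeries 1 = 0#
  edgeCycleSeries 2 = listSum R (edges G) (λ (i , j) → wg i j * wg i j)
  edgeCycleSeries k@(suc (suc (suc _))) = (1# + 1#) * cycleSum k

-- det(I - tXM) as an element of R[x₁,…,xₙ]⟦t⟧.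
det[I-tXM] : (R : RawRing c ℓ) → Matrix R n → ∣ R [X^ n ] ⟦t⟧ ∣
det[I-tXM] {n = n} R M = det S (_⊝_ S (identity S) (_⊙_ S (t A) (_⊗_ S X M′)))
  where
  A = R [X^ n ]
  S = A ⟦t⟧
  X M′ : Matrix S n
  X = diag S (λ i → constₜ A (var R i))
  M′ i j = constₜ A (const R n (M i j))

ℤ[w,r] ℚ[w,r] : RawRing 0ℓ 0ℓ
ℤ[w,r] = ℤ.+-*-rawRing [X^ 2 ]
ℚ[w,r] = ℚ.+-*-rawRing [X^ 2 ]

ι : ∣ ℤ[w,r] ∣ → ∣ ℚ[w,r] ∣
ι = mapCoeffs ℤ.+-*-rawRing ℚ.+-*-rawRing 2 (λ z → z / 1)

ιₜ : ∣ ℤ[w,r] ⟦t⟧ ∣ → ∣ ℚ[w,r] ⟦t⟧ ∣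
ιₜ f k = ι (f k)

ιₓₜ : ∣ ℤ[w,r] [X^ n ] ⟦t⟧ ∣ → ∣ ℚ[w,r] [X^ n ] ⟦t⟧ ∣
ιₓₜ {n} f k = mapCoeffs ℤ[w,r] ℚ[w,r] n ι (f k)

logₓₜ : ∣ ℚ[w,r] [X^ n ] ⟦t⟧ ∣ → ∣ ℚ[w,r] [X^ n ] ⟦t⟧ ∣
logₓₜ {n} = log (ℚ[w,r] [X^ n ]) (λ q → const ℚ[w,r] n (const ℚ.+-*-rawRing 2 q))

sqₜ : ∣ ℚ[w,r] [X^ n ] ⟦t⟧ ∣ → ∣ ℚ[w,r] ⟦t⟧ ∣
sqₜ {n} f k = sq {n = n} ℚ[w,r] (f k)

sqNegLogDet : {G : SimpleGraph n} → EdgeWeights ℤ[w,r] G → ∣ ℚ[w,r] ⟦t⟧ ∣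
sqNegLogDet {n} W =
  sqₜ {n} (- logₓₜ {n} (ιₓₜ {n} (det[I-tXM] ℤ[w,r] (adjacency ℤ[w,r] W))))
  where open RawRing (ℚ[w,r] [X^ n ] ⟦t⟧) using (-_)

{-# OPTIONS --safe #-}
module Submission where

-- In R[x₁,…,xₙ]/(xᵢ²), an algebra of iterated dual numbers in which sq becomes a linear
-- functional, put N = tXM and P = Σ_{k≥1} Nᵏ, and let θ = t d/dt. Since N = P (I - N) and
-- θ(I - N) = -N, replacing row i of I - N by its θ-derivative gives -Σ_l Pᵢₗ (row l), whose
-- determinant is -Pᵢᵢ det(I - N); hence θ det(I - N) = -tr P · det(I - N), and so
-- k [tᵏ](-log det(I - N)) = tr (XM)ᵏ, the sum over closed walks of length k. Only walks
-- without repeated vertices survive modulo the xᵢ², each with total coefficient 1. For k ≥ 3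
-- these are the cycles, each read off in 2k ways, and for k = 2 the edges, each in 2 ways.

open import Algebra.Bundles using (CommutativeRing)
open import Algebra.Bundles.Raw using (RawRing)
import Algebra.Definitions.RawSemiring as RawSemiringDefs
import Algebra.Properties.AbelianGroup as AbelianGroupProperties
import Algebra.Properties.CommutativeMonoid.Mult as CommutativeMonoidMult
import Algebra.Properties.CommutativeSemigroup as CommutativeSemigroupProperties
import Algebra.Properties.Ring as RingProperties
import Algebra.Properties.Semiring.Exp as SemiringExp
import Algebra.Properties.Semiring.Mult as SemiringMult
import Algebra.Properties.Semiring.Sum as SemiringSum
import Algebra.Solver.Ring.NaturalCoefficients.Default as SemiringSolver
open import Data.Bool.Base using (if_then_else_)
open import Data.Fin.Base as Fin using (Fin; zero; suc; toℕ; punchIn; inject₁)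
open import Data.Fin.Induction using (<-weakInduction)
import Data.Fin.Properties as Fin
open import Data.Integer.Base as ℤ using (-1ℤ; 1ℤ; +_)
import Data.Integer.Properties as ℤ
open import Data.List.Base as List using (List; []; _∷_; _++_; allFin; cartesianProduct;
  cartesianProductWith; concatMap; deduplicate; filter; iterate)
import Data.List.Properties as List
open import Data.List.Membership.Propositional using (_∈_; find)
import Data.List.Membership.Propositional.Properties as ∈
import Data.List.Membership.Propositional.Properties.WithK as ∈
open import Data.List.Relation.Binary.BagAndSetEquality using (∼bag⇒↭)
open import Data.List.Relation.Binary.Disjoint.Propositional using (Disjoint)
open import Data.List.Relation.Binary.Permutation.Propositional as ↭ using (_↭_)
import Data.List.Relation.Unary.All as ListAll
import Data.List.Relation.Unary.All.Properties as ListAll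
import Data.List.Relation.Unary.AllPairs as ListAllPairs
import Data.List.Relation.Unary.AllPairs.Properties as ListAllPairs
open import Data.List.Relation.Unary.Any as ListAny using (here; there)
import Data.List.Relation.Unary.Any.Properties as ListAny
import Data.List.Relation.Unary.Unique.Propositional as List
import Data.List.Relation.Unary.Unique.Propositional.Properties as ListUnique
open import Data.Nat.Base as ℕ using (ℕ; zero; suc; _∸_; _≤_; z≤n; s≤s)
import Data.Nat.Properties as ℕ
open import Data.Product.Base using (_×_; _,_; proj₁; proj₂; swap; uncurry)
open import Data.Rational.Base as ℚ using (ℚ; _/_; fromℚᵘ)
import Data.Rational.Properties as ℚ
import Data.Rational.Unnormalised.Base as ℚᵘ
import Data.Rational.Unnormalised.Properties as ℚᵘ
open import Data.Sum.Base using (_⊎_; inj₁; inj₂; [_,_]′)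
open import Data.Vec.Base as Vec using (Vec; []; _∷_; _∷ʳ_; reverse; toList; zip)
import Data.Vec.Properties as Vec
open import Data.Vec.Relation.Unary.All as All using (All; []; _∷_)
import Data.Vec.Relation.Unary.All.Properties as All
open import Data.Vec.Relation.Unary.AllPairs as AllPairs using ([]; _∷_)
open import Data.Vec.Relation.Unary.Unique.Propositional using (Unique)
import Data.Vec.Relation.Unary.Unique.Propositional.Properties as Unique
open import Function.Base using (_∘_; _⟨_⟩_; id)
open import Function.Bundles using (mk↔ₛ′)
open import Level using (Level; _⊔_)
open import Relation.Binary.Core using (Rel)
import Relation.Binary.Definitions as Binary
open import Relation.Binary.PropositionalEquality.Core as ≡ using (_≡_; _≢_)
open import Relation.Binary.PropositionalEquality.Properties using (module ≡-Reasoning)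
import Relation.Binary.Reasoning.Setoid as SetoidReasoning
open import Relation.Nullary.Decidable using (Dec; yes; no; does; ¬?; dec-true; dec-false)
open import Relation.Nullary.Negation using (¬_; contradiction)
open import Relation.Unary using (Pred; Decidable)
open import Defs

-- The map `sq` is linear but not multiplicative, so it cannot be pushed through a determinant or a
-- logarithm. It factors through reduction modulo the xᵢ², which is a ring homomorphism, and both
-- constructions can therefore be carried out after reducing. Coefficient lists enter only as
-- sources of homomorphisms; the algebra itself takes place in power series and dual numbers. The
-- determinant step rests on two facts drawn from the Laplace expansion: linearity in each row, and
-- vanishing when two rows agree. A row of θ(I - N) is a combination of all rows of I - N, and only
-- the diagonal coefficient survives. For the logarithm, put F = det(I - N), H = -tr P and u = F -
-- 1. Then θu = H (1 + u), so θ applied to the truncated sum of (-1)ʲ⁺¹ uʲ / j telescopes to H in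
-- degree k. This determines only k times coefficient k: for k ≥ 1 the factor is cancelled by the
-- ℚ-algebra structure, and k = 0 is treated separately. Edges are separated from cycles because at
-- length 2 reversal is itself a rotation, so the count of 2k readings fails there.

private variable
  c ℓ c′ ℓ′ c″ ℓ″ p : Level
  A B : Set
  k m n : ℕ

-- Power series and dual numbers

module _ (R : CommutativeRing c ℓ) where
  open CommutativeRing R
  open SemiringSum semiring using (sum; sum-cong-≋)
  open SetoidReasoning setoid
  open SemiringSolver commutativeSemiring using (solve; _:+_; _:*_; _:=_; con)

  private
    module S = RawRing (rawRing ⟦t⟧)

  -- Coefficient k + 1 of f * g unfolds definitionally to f 0 * g (k + 1) plus coefficient k of (f ∘
  -- suc) * g. The product laws below are inductions on k along this unfolding, with the first
  -- factor kept general.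
  series-*-cong : ∀ {f f′ g g′} → f S.≈ f′ → g S.≈ g′ → f S.* g S.≈ f′ S.* g′
  series-*-cong {f} {f′} p q zero    = +-congʳ (*-cong (p 0) (q 0))
  series-*-cong {f} {f′} p q (suc k) =
    +-cong (*-cong (p 0) (q (suc k))) (series-*-cong {f ∘ suc} {f′ ∘ suc} (p ∘ suc) q k)

  series-zeroˡ : ∀ g → S.0# S.* g S.≈ S.0#
  series-zeroˡ g zero    = trans (+-identityʳ _) (zeroˡ _)
  series-zeroˡ g (suc k) = trans (+-cong (zeroˡ _) (series-zeroˡ g k)) (+-identityʳ _)

  series-identityˡ : ∀ g → S.1# S.* g S.≈ g
  series-identityˡ g zero    = trans (+-identityʳ _) (*-identityˡ _)
  series-identityˡ g (suc k) = trans (+-cong (*-identityˡ _) (series-zeroˡ g k)) (+-identityʳ _)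

  series-distribʳ : ∀ h f g → (f S.+ g) S.* h S.≈ f S.* h S.+ g S.* h
  series-distribʳ h f g zero    =
    solve 3 (λ f g h → (f :+ g) :* h :+ con 0 := (f :* h :+ con 0) :+ (g :* h :+ con 0))
      refl (f 0) (g 0) (h 0)
  series-distribʳ h f g (suc k) = begin
    (f 0 + g 0) * h (suc k) + ((f ∘ suc S.+ g ∘ suc) S.* h) k
      ≈⟨ +-congˡ (series-distribʳ h (f ∘ suc) (g ∘ suc) k) ⟩
    (f 0 + g 0) * h (suc k) + ((f ∘ suc S.* h) k + (g ∘ suc S.* h) k)
      ≈⟨ solve 5 (λ f g h x y → (f :+ g) :* h :+ (x :+ y) := (f :* h :+ x) :+ (g :* h :+ y))
           refl (f 0) (g 0) (h (suc k)) _ _ ⟩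
    (f 0 * h (suc k) + (f ∘ suc S.* h) k) + (g 0 * h (suc k) + (g ∘ suc S.* h) k) ∎

  -- The definitional unfolding shifts only the first factor. Splitting off the last summand shifts
  -- the second one instead, and comparing the two gives commutativity.
  series-*-last : ∀ f g k → (f S.* g) (suc k) ≈ (f S.* (g ∘ suc)) k + f (suc k) * g 0
  series-*-last f g zero    = sym (+-assoc _ _ _) ⟨ trans ⟩ +-identityʳ _ ⟨ trans ⟩ +-cong (sym (+-identityʳ _)) refl
  series-*-last f g (suc k) = begin
    f 0 * g (suc (suc k)) + ((f ∘ suc) S.* g) (suc k)
      ≈⟨ +-congˡ (series-*-last (f ∘ suc) g k) ⟩
    f 0 * g (suc (suc k)) + (((f ∘ suc) S.* (g ∘ suc)) k + f (suc (suc k)) * g 0)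
      ≈⟨ +-assoc _ _ _ ⟨
    (f 0 * g (suc (suc k)) + ((f ∘ suc) S.* (g ∘ suc)) k) + f (suc (suc k)) * g 0 ∎

  series-*-comm : ∀ f g → f S.* g S.≈ g S.* f
  series-*-comm f g zero    = +-congʳ (*-comm _ _)
  series-*-comm f g (suc k) = begin
    f 0 * g (suc k) + ((f ∘ suc) S.* g) k ≈⟨ +-cong (*-comm _ _) (series-*-comm (f ∘ suc) g k) ⟩
    g (suc k) * f 0 + (g S.* (f ∘ suc)) k ≈⟨ +-comm _ _ ⟩
    (g S.* (f ∘ suc)) k + g (suc k) * f 0 ≈⟨ series-*-last g f k ⟨
    (g S.* f) (suc k)                     ∎

  series-*-scaleˡ : ∀ a f g k → ((λ i → a * f i) S.* g) k ≈ a * (f S.* g) k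
  series-*-scaleˡ a f g zero    =
    trans (+-identityʳ _) (trans (*-assoc _ _ _) (*-congˡ (sym (+-identityʳ _))))
  series-*-scaleˡ a f g (suc k) = begin
    a * f 0 * g (suc k) + ((λ i → a * f (suc i)) S.* g) k
      ≈⟨ +-cong (*-assoc _ _ _) (series-*-scaleˡ a (f ∘ suc) g k) ⟩
    a * (f 0 * g (suc k)) + a * ((f ∘ suc) S.* g) k
      ≈⟨ distribˡ _ _ _ ⟨
    a * (f S.* g) (suc k) ∎

  series-*-assoc : ∀ f g h → (f S.* g) S.* h S.≈ f S.* (g S.* h)
  series-*-assoc f g h zero    = +-congʳ (begin
    (f 0 * g 0 + 0#) * h 0 ≈⟨ *-congʳ (+-identityʳ _) ⟩
    f 0 * g 0 * h 0        ≈⟨ *-assoc _ _ _ ⟩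
    f 0 * (g 0 * h 0)      ≈⟨ *-congˡ (+-identityʳ _) ⟨
    f 0 * (g 0 * h 0 + 0#) ∎)
  series-*-assoc f g h (suc k) = begin
    (f 0 * g 0 + 0#) * h (suc k) + (((λ i → f 0 * g (suc i)) S.+ f ∘ suc S.* g) S.* h) k
      ≈⟨ +-cong (*-congʳ (+-identityʳ _)) (series-distribʳ h (λ i → f 0 * g (suc i)) (f ∘ suc S.* g) k) ⟩
    f 0 * g 0 * h (suc k) + (((λ i → f 0 * g (suc i)) S.* h) k + ((f ∘ suc S.* g) S.* h) k)
      ≈⟨ +-congˡ (+-cong (series-*-scaleˡ (f 0) (g ∘ suc) h k) (series-*-assoc (f ∘ suc) g h k)) ⟩
    f 0 * g 0 * h (suc k) + (f 0 * (g ∘ suc S.* h) k + (f ∘ suc S.* (g S.* h)) k)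
      ≈⟨ solve 5 (λ f g h x y → f :* g :* h :+ (f :* x :+ y) := f :* (g :* h :+ x) :+ y)
           refl (f 0) (g 0) (h (suc k)) _ _ ⟩
    f 0 * (g 0 * h (suc k) + (g ∘ suc S.* h) k) + (f ∘ suc S.* (g S.* h)) k ∎

  seriesRing : CommutativeRing c ℓ
  seriesRing = record
    { RawRing (rawRing ⟦t⟧)
    ; isCommutativeRing = record
      { isRing = record
        { +-isAbelianGroup = record
          { isGroup = record
            { isMonoid = record
              { isSemigroup = record
                { isMagma = record
                  { isEquivalence = record
                    { refl = λ _ → refl ; sym = λ p k → sym (p k) ; trans = λ p q k → trans (p k) (q k) }
                  ; ∙-cong = λ p q k → +-cong (p k) (q k)
                  }
                ; assoc = λ _ _ _ _ → +-assoc _ _ _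
                }
              ; identity = (λ _ _ → +-identityˡ _) , (λ _ _ → +-identityʳ _)
              }
            ; inverse = (λ _ _ → -‿inverseˡ _) , (λ _ _ → -‿inverseʳ _)
            ; ⁻¹-cong = λ p k → -‿cong (p k)
            }
          ; comm = λ _ _ _ → +-comm _ _
          }
        ; *-cong     = λ {f} {f′} → series-*-cong {f} {f′}
        ; *-assoc    = series-*-assoc
        ; *-identity = series-identityˡ , λ f k → trans (series-*-comm f S.1# k) (series-identityˡ f k)
        ; distrib    =
            (λ f g h k → trans (series-*-comm f (g S.+ h) k)
                       (trans (series-distribʳ f g h k)
                              (+-cong (series-*-comm g f k) (series-*-comm h f k))))
          , series-distribʳ
        }
      ; *-comm = series-*-comm
      }
    }

  -- The pair (a , b) is a + b x with x² = 0, hence the absence of a b * b′ term in the product.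
  dualNumbers : RawRing c ℓ
  dualNumbers = record
    { Carrier = Carrier × Carrier
    ; _≈_     = λ (a , b) (a′ , b′) → a ≈ a′ × b ≈ b′
    ; _+_     = λ (a , b) (a′ , b′) → a + a′ , b + b′
    ; _*_     = λ (a , b) (a′ , b′) → a * a′ , a * b′ + b * a′
    ; -_      = λ (a , b) → - a , - b
    ; 0#      = 0# , 0#
    ; 1#      = 1# , 0#
    }

  dualNumberRing : CommutativeRing c ℓ
  dualNumberRing = record
    { RawRing dualNumbers
    ; isCommutativeRing = record
      { isRing = record
        { +-isAbelianGroup = record
          { isGroup = record
            { isMonoid = record
              { isSemigroup = record
                { isMagma = record
                  { isEquivalence = record
                    { refl  = refl , refl
                    ; sym   = λ (p , q) → sym p , sym q
                    ; trans = λ (p , q) (p′ , q′) → trans p p′ , trans q q′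
                    }
                  ; ∙-cong = λ (p , q) (p′ , q′) → +-cong p p′ , +-cong q q′
                  }
                ; assoc = λ _ _ _ → +-assoc _ _ _ , +-assoc _ _ _
                }
              ; identity = (λ _ → +-identityˡ _ , +-identityˡ _) , (λ _ → +-identityʳ _ , +-identityʳ _)
              }
            ; inverse = (λ _ → -‿inverseˡ _ , -‿inverseˡ _) , (λ _ → -‿inverseʳ _ , -‿inverseʳ _)
            ; ⁻¹-cong = λ (p , q) → -‿cong p , -‿cong q
            }
          ; comm = λ _ _ → +-comm _ _ , +-comm _ _
          }
        ; *-cong     = λ (p , q) (p′ , q′) → *-cong p p′ , +-cong (*-cong p q′) (*-cong q p′)
        ; *-assoc    = λ (a , a′) (b , b′) (c , c′) → *-assoc _ _ _ ,
            solve 6 (λ a a′ b b′ c c′ → a :* b :* c′ :+ (a :* b′ :+ a′ :* b) :* c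
                                     := a :* (b :* c′ :+ b′ :* c) :+ a′ :* (b :* c))
              refl a a′ b b′ c c′
        ; *-identity =
            (λ (a , a′) → *-identityˡ _ ,
               trans (+-cong (*-identityˡ _) (zeroˡ _)) (+-identityʳ _))
          , (λ (a , a′) → *-identityʳ _ ,
               trans (+-cong (zeroʳ _) (*-identityʳ _)) (+-identityˡ _))
        ; distrib    =
            (λ (a , a′) (b , b′) (c , c′) → distribˡ _ _ _ ,
               solve 6 (λ a a′ b b′ c c′ → a :* (b′ :+ c′) :+ a′ :* (b :+ c)
                                        := (a :* b′ :+ a′ :* b) :+ (a :* c′ :+ a′ :* c))
                 refl a a′ b b′ c c′)
          , (λ (a , a′) (b , b′) (c , c′) → distribʳ _ _ _ ,
               solve 6 (λ a a′ b b′ c c′ → (b :+ c) :* a′ :+ (b′ :+ c′) :* a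
                                        := (b :* a′ :+ b′ :* a) :+ (c :* a′ :+ c′ :* a))
                 refl a a′ b b′ c c′)
        }
      ; *-comm = λ _ _ → *-comm _ _ ,
          trans (+-comm _ _) (+-cong (*-comm _ _) (*-comm _ _))
      }
    }

-- Homomorphisms

-- Sources are raw rings, so that coefficient lists qualify. Compatibility with zero and negation is
-- therefore a field instead of a consequence of additivity.
record IsHom (R : RawRing c ℓ) (S : RawRing c′ ℓ′) (h : ∣ R ∣ → ∣ S ∣) : Set (c ⊔ ℓ ⊔ ℓ′) where
  private
    module R = RawRing R
    module S = RawRing S
  field
    cong    : ∀ {x y} → x R.≈ y → h x S.≈ h y
    +-homo  : ∀ x y → h (x R.+ y) S.≈ h x S.+ h y
    *-homo  : ∀ x y → h (x R.* y) S.≈ h x S.* h y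
    -‿homo  : ∀ x → h (R.- x) S.≈ S.- h x
    0#-homo : h R.0# S.≈ S.0#
    1#-homo : h R.1# S.≈ S.1#

module _ (S : CommutativeRing c ℓ) where
  open CommutativeRing S hiding (zero)
  open SemiringSum semiring using (sum; sum-cong-≋)
  open SemiringExp semiring using (_^_)

  det-cong : ∀ {n} {A B : Matrix rawRing n} → (∀ i j → A i j ≈ B i j) → det rawRing A ≈ det rawRing B
  det-cong {zero}  eq = refl
  det-cong {suc n} eq = sum-cong-≋ (λ j →
    *-congˡ {(- 1#) ^ toℕ j} (*-cong (eq zero j) (det-cong (λ i l → eq (suc i) (punchIn j l)))))

  log-cong : ∀ (ρ : ℚ → Carrier) {F G : ∣ rawRing ⟦t⟧ ∣} → (∀ k → F k ≈ G k) →
             ∀ k → log rawRing ρ F k ≈ log rawRing ρ G k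
  log-cong ρ {F} {G} eq k = sum-cong-≋ {k} (λ i → *-congˡ
    (SemiringExp.^-congˡ (CommutativeRing.semiring (seriesRing S)) (suc (toℕ i)) (λ m → +-congʳ (eq m)) k))

module _ (R : RawRing c ℓ) (S : CommutativeRing c′ ℓ′) {h : ∣ R ∣ → CommutativeRing.Carrier S}
         (isHom : IsHom R (CommutativeRing.rawRing S) h) where
  private
    module R where
      open RawRing R public
      open RawSemiringDefs rawSemiring public using (sum; _^_)
  open CommutativeRing S hiding (zero)
  open SemiringSum semiring using (sum; sum-cong-≋)
  open SemiringExp semiring using (_^_)
  open IsHom isHom
  open SetoidReasoning setoid

  sum-homo : ∀ {n} (f : Fin n → R.Carrier) → h (R.sum f) ≈ sum (h ∘ f)
  sum-homo {zero}  f = 0#-homo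
  sum-homo {suc n} f = trans (+-homo _ _) (+-congˡ (sum-homo (f ∘ suc)))

  ^-homo : ∀ x k → h (x R.^ k) ≈ h x ^ k
  ^-homo x zero    = 1#-homo
  ^-homo x (suc k) = trans (*-homo _ _) (*-congˡ (^-homo x k))

  det-homo : ∀ {n} (A : Matrix R n) → h (det R A) ≈ det rawRing (λ i j → h (A i j))
  det-homo {zero}  A = 1#-homo
  det-homo {suc n} A = trans (sum-homo term) (sum-cong-≋ λ j → begin
    h ((R.- R.1#) R.^ toℕ j R.* (A zero j R.* det R (minor j)))
      ≈⟨ *-homo _ _ ⟩
    h ((R.- R.1#) R.^ toℕ j) * h (A zero j R.* det R (minor j))
      ≈⟨ *-cong (^-homo _ (toℕ j)) (*-homo _ _) ⟩
    h (R.- R.1#) ^ toℕ j * (h (A zero j) * h (det R (minor j)))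
      ≈⟨ *-cong (SemiringExp.^-congˡ semiring (toℕ j) (trans (-‿homo _) (-‿cong 1#-homo)))
                (*-congˡ (det-homo (minor j))) ⟩
    (- 1#) ^ toℕ j * (h (A zero j) * det rawRing (λ i l → h (minor j i l))) ∎)
    where
    minor : Fin (suc n) → Matrix R n
    minor j i l = A (suc i) (punchIn j l)
    term : Fin (suc n) → R.Carrier
    term j = (R.- R.1#) R.^ toℕ j R.* (A zero j R.* det R (minor j))

  series-isHom : IsHom (R ⟦t⟧) (rawRing ⟦t⟧) (h ∘_)
  series-isHom = record
    { cong    = λ p k → cong (p k)
    ; +-homo  = λ _ _ _ → +-homo _ _
    ; *-homo  = λ f g k → trans (sum-homo {suc k} (λ i → f (toℕ i) R.* g (k ∸ toℕ i)))
                               (sum-cong-≋ {suc k} λ i → *-homo (f (toℕ i)) (g (k ∸ toℕ i)))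
    ; -‿homo  = λ _ _ → -‿homo _
    ; 0#-homo = λ _ → 0#-homo
    ; 1#-homo = λ { zero → 1#-homo ; (suc _) → 0#-homo }
    }

  private
    polyHom : List R.Carrier → ℕ → Carrier
    polyHom p k = h (coeff R p k)

    module T = CommutativeRing (seriesRing S)

  coeff-+ₚ : ∀ p q k → h (coeff R (_+ₚ_ R p q) k) ≈ h (coeff R p k) + h (coeff R q k)
  coeff-+ₚ []      q       k       = trans (sym (+-identityˡ _)) (+-congʳ (sym 0#-homo))
  coeff-+ₚ (a ∷ p) []      k       = trans (sym (+-identityʳ _)) (+-congˡ (sym 0#-homo))
  coeff-+ₚ (a ∷ p) (b ∷ q) zero    = +-homo a b
  coeff-+ₚ (a ∷ p) (b ∷ q) (suc k) = coeff-+ₚ p q k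

  coeff-scale : ∀ a q k → h (coeff R (List.map (a R.*_) q) k) ≈ h a * h (coeff R q k)
  coeff-scale a []      k       = trans 0#-homo (trans (sym (zeroʳ _)) (*-congˡ (sym 0#-homo)))
  coeff-scale a (b ∷ q) zero    = *-homo a b
  coeff-scale a (b ∷ q) (suc k) = coeff-scale a q k

  -- The recursion of `_*ₚ_` on its first list mirrors the unfolding of the series product: the head
  -- of p contributes a multiple of q, the tail a product shifted by one degree.
  coeff-*ₚ : ∀ p q → polyHom (_*ₚ_ R p q) T.≈ polyHom p T.* polyHom q
  coeff-*ₚ []      q k       = trans 0#-homo (sym (trans (T.*-congʳ {polyHom q} (λ _ → 0#-homo) k) (T.zeroˡ (polyHom q) k)))
  coeff-*ₚ (a ∷ p) q zero    =
    trans (coeff-+ₚ (List.map (a R.*_) q) _ 0) (+-cong (coeff-scale a q 0) 0#-homo)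
  coeff-*ₚ (a ∷ p) q (suc k) =
    trans (coeff-+ₚ (List.map (a R.*_) q) _ (suc k)) (+-cong (coeff-scale a q (suc k)) (coeff-*ₚ p q k))

  coeff-neg : ∀ p k → h (coeff R (List.map (R.-_) p) k) ≈ - h (coeff R p k)
  coeff-neg []      k       = trans 0#-homo (trans (sym -0#≈0#) (-‿cong (sym 0#-homo)))
    where open RingProperties ring using (-0#≈0#)
  coeff-neg (a ∷ p) zero    = -‿homo a
  coeff-neg (a ∷ p) (suc k) = coeff-neg p k

  -- Polynomials are viewed as power series, where the ring laws are established. Iterating this
  -- treats several variables.
  poly-isHom : IsHom (Poly R) (rawRing ⟦t⟧) (λ p k → h (coeff R p k))
  poly-isHom = record
    { cong    = λ p k → cong (p k)
    ; +-homo  = coeff-+ₚ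
    ; *-homo  = coeff-*ₚ
    ; -‿homo  = coeff-neg
    ; 0#-homo = λ _ → 0#-homo
    ; 1#-homo = λ { zero → 1#-homo ; (suc _) → 0#-homo }
    }

module _ (R : RawRing c ℓ) (S : CommutativeRing c′ ℓ′) {h : ∣ R ∣ → CommutativeRing.Carrier S}
         (isHom : IsHom R (CommutativeRing.rawRing S) h) where
  private
    module R = RawRing R
    module RT where
      open RawRing (R ⟦t⟧) public
      open RawSemiringDefs rawSemiring public using (_^_)
    module ST where
      open CommutativeRing (seriesRing S) public
      open SemiringExp semiring public using (_^_; ^-congˡ)
    module H = IsHom (series-isHom R S isHom)
  open CommutativeRing S
  open SemiringSum semiring using (sum-cong-≋)

  -- In each degree `log` is a finite expression in sums, products and powers, so it commutes with
  -- homomorphisms once the structure map is transported along.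
  log-homo : ∀ (ρ : ℚ → R.Carrier) F k → h (log R ρ F k) ≈ log rawRing (h ∘ ρ) (h ∘ F) k
  log-homo ρ F k = trans (sum-homo R S isHom {k} _) (sum-cong-≋ {k} λ i →
    trans (IsHom.*-homo isHom _ _) (*-congˡ (power-homo (suc (toℕ i)) k)))
    where
    u : RT.Carrier
    u = F RT.+ RT.- RT.1#
    power-homo : ∀ j → h ∘ (u RT.^ j) ST.≈ ((h ∘ F) ST.+ ST.- ST.1#) ST.^ j
    power-homo j = ST.trans {h ∘ (u RT.^ j)} {(h ∘ u) ST.^ j}
      (^-homo (R ⟦t⟧) (seriesRing S) (series-isHom R S isHom) u j)
      (ST.^-congˡ j λ m → trans (H.+-homo F (RT.- RT.1#) m) (+-congˡ (trans (H.-‿homo RT.1# m) (-‿cong (H.1#-homo m)))))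

-- Squarefree parts

module _ (K : CommutativeRing c ℓ) where
  open CommutativeRing K hiding (zero)
  open SemiringSum semiring using (sum)

  listSum-cong : ∀ (xs : List A) {f g : A → Carrier} → (∀ x → f x ≈ g x) →
                 listSum rawRing xs f ≈ listSum rawRing xs g
  listSum-cong []       eq = refl
  listSum-cong (x ∷ xs) eq = +-cong (eq x) (listSum-cong xs eq)

  listSum-++ : ∀ (xs ys : List A) (f : A → Carrier) →
               listSum rawRing (xs ++ ys) f ≈ listSum rawRing xs f + listSum rawRing ys f
  listSum-++ []       ys f = sym (+-identityˡ _)
  listSum-++ (x ∷ xs) ys f = trans (+-congˡ (listSum-++ xs ys f)) (sym (+-assoc _ _ _))

  listSum-map : ∀ (g : A → B) (xs : List A) (f : B → Carrier) →
                listSum rawRing (List.map g xs) f ≈ listSum rawRing xs (f ∘ g)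
  listSum-map g []       f = refl
  listSum-map g (x ∷ xs) f = +-congˡ (listSum-map g xs f)

  listSum-cartesianProductWith : ∀ {C : Set} (g : A → B → C) (xs : List A) (ys : List B) (f : C → Carrier) →
    listSum rawRing (cartesianProductWith g xs ys) f ≈ listSum rawRing xs (λ x → listSum rawRing ys (λ y → f (g x y)))
  listSum-cartesianProductWith g []       ys f = refl
  listSum-cartesianProductWith g (x ∷ xs) ys f = trans (listSum-++ (List.map (g x) ys) _ f)
    (+-cong (listSum-map (g x) ys f) (listSum-cartesianProductWith g xs ys f))

  *-distribˡ-listSum : ∀ a (xs : List A) (f : A → Carrier) → a * listSum rawRing xs f ≈ listSum rawRing xs (λ x → a * f x)
  *-distribˡ-listSum a []       f = zeroʳ a
  *-distribˡ-listSum a (x ∷ xs) f = trans (distribˡ _ _ _) (+-congˡ (*-distribˡ-listSum a xs f))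

  listSum-tabulate : ∀ {n} (g : Fin n → A) (f : A → Carrier) → listSum rawRing (List.tabulate g) f ≈ sum (f ∘ g)
  listSum-tabulate {n = zero}  g f = refl
  listSum-tabulate {n = suc n} g f = +-congˡ (listSum-tabulate (g ∘ suc) f)

  listSum-allFin : ∀ n (f : Fin n → Carrier) → listSum rawRing (allFin n) f ≈ sum f
  listSum-allFin n = listSum-tabulate {n = n} id

listSum-homo : (R : RawRing c′ ℓ′) (K : CommutativeRing c ℓ) {h : ∣ R ∣ → CommutativeRing.Carrier K} →
               IsHom R (CommutativeRing.rawRing K) h → ∀ (xs : List A) f →
               CommutativeRing._≈_ K (h (listSum R xs f)) (listSum (CommutativeRing.rawRing K) xs (h ∘ f))
listSum-homo R K isHom []       f = IsHom.0#-homo isHom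
listSum-homo R K isHom (x ∷ xs) f =
  CommutativeRing.trans K (IsHom.+-homo isHom _ _) (CommutativeRing.+-congˡ K (listSum-homo R K isHom xs f))

-- The algebra modulo the squares of the variables

module _ (K : CommutativeRing c ℓ) where
  private
    module K = CommutativeRing K

  -- K[x₁,…,xₙ]/(x₁²,…,xₙ²), as iterated dual numbers.
  squarefreeRing : ℕ → CommutativeRing c ℓ
  squarefreeRing zero    = K
  squarefreeRing (suc n) = dualNumberRing (squarefreeRing n)

  private
    module Sq n = CommutativeRing (squarefreeRing n)

  scalar : ∀ n → K.Carrier → Sq.Carrier n
  scalar zero    a = a
  scalar (suc n) a = scalar n a , Sq.0# n

  scalar-isHom : ∀ n → IsHom K.rawRing (Sq.rawRing n) (scalar n)
  scalar-isHom zero    = record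
    { cong = id ; +-homo = λ _ _ → K.refl ; *-homo = λ _ _ → K.refl ; -‿homo = λ _ → K.refl
    ; 0#-homo = K.refl ; 1#-homo = K.refl }
  scalar-isHom (suc n) = record
    { cong    = λ p → H.cong p , S.refl
    ; +-homo  = λ a b → H.+-homo a b , S.sym (S.+-identityˡ _)
    ; *-homo  = λ a b → H.*-homo a b , S.sym (S.trans (S.+-cong (S.zeroʳ _) (S.zeroˡ _)) (S.+-identityˡ _))
    ; -‿homo  = λ a → H.-‿homo a , S.sym -0#≈0#
    ; 0#-homo = H.0#-homo , S.refl
    ; 1#-homo = H.1#-homo , S.refl
    }
    where
    module H = IsHom (scalar-isHom n)
    module S = Sq n
    open RingProperties S.ring using (-0#≈0#)

  gen : Fin n → Sq.Carrier n
  gen {suc n} zero    = Sq.0# n , Sq.1# n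
  gen {suc n} (suc i) = gen i , Sq.0# n

  -- This is what `sq` becomes after reduction. It is not multiplicative, since x₁ has total 1 while
  -- x₁² = 0; the predicate `Free` below isolates the products on which it behaves well.
  total : ∀ n → Sq.Carrier n → K.Carrier
  total zero    a       = a
  total (suc n) (a , b) = total n a K.+ total n b

  total-cong : ∀ n {a b} → Sq._≈_ n a b → total n a K.≈ total n b
  total-cong zero    p       = p
  total-cong (suc n) (p , q) = K.+-cong (total-cong n p) (total-cong n q)

  total-+ : ∀ n a b → total n (Sq._+_ n a b) K.≈ total n a K.+ total n b
  total-+ zero    a        b        = K.refl
  total-+ (suc n) (a , a′) (b , b′) =
    K.trans (K.+-cong (total-+ n a b) (total-+ n a′ b′)) (interchange _ _ _ _)
    where open CommutativeSemigroupProperties K.+-commutativeSemigroup using (interchange)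

  total-0 : ∀ n → total n (Sq.0# n) K.≈ K.0#
  total-0 zero    = K.refl
  total-0 (suc n) = K.trans (K.+-cong (total-0 n) (total-0 n)) (K.+-identityˡ _)

  total-scalar-* : ∀ n a b → total n (Sq._*_ n (scalar n a) b) K.≈ a K.* total n b
  total-scalar-* zero    a b        = K.refl
  total-scalar-* (suc n) a (b , b′) = begin
    total n (scalar n a S.* b) K.+ total n (scalar n a S.* b′ S.+ S.0# S.* b)
      ≈⟨ K.+-congˡ (total-cong n (S.trans (S.+-congˡ (S.zeroˡ b)) (S.+-identityʳ _))) ⟩
    total n (scalar n a S.* b) K.+ total n (scalar n a S.* b′)
      ≈⟨ K.+-cong (total-scalar-* n a b) (total-scalar-* n a b′) ⟩
    a K.* total n b K.+ a K.* total n b′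
      ≈⟨ K.distribˡ _ _ _ ⟨
    a K.* (total n b K.+ total n b′) ∎
    where
    module S = Sq n
    open SetoidReasoning K.setoid

  total-1 : ∀ n → total n (Sq.1# n) K.≈ K.1#
  total-1 zero    = K.refl
  total-1 (suc n) = K.trans (K.+-cong (total-1 n) (total-0 n)) (K.+-identityʳ _)

  total-listSum : ∀ n (xs : List A) f →
                  total n (listSum (Sq.rawRing n) xs f) K.≈ listSum K.rawRing xs (total n ∘ f)
  total-listSum n []       f = total-0 n
  total-listSum n (x ∷ xs) f = K.trans (total-+ n _ _) (K.+-congˡ (total-listSum n xs f))

  -- b ∈ K[xⱼ : j ≠ i]
  Free : ∀ {n} → Fin n → Sq.Carrier n → Set ℓ
  Free {suc n} zero    (a , b) = Sq._≈_ n b (Sq.0# n)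
  Free {suc n} (suc i) (a , b) = Free i a × Free i b

  Free-0 : ∀ {n} (i : Fin n) → Free i (Sq.0# n)
  Free-0 {suc n} zero    = Sq.refl n
  Free-0 {suc n} (suc i) = Free-0 i , Free-0 i

  Free-1 : ∀ {n} (i : Fin n) → Free i (Sq.1# n)
  Free-1 {suc n} zero    = Sq.refl n
  Free-1 {suc n} (suc i) = Free-1 i , Free-0 i

  Free-cong : ∀ {n} (i : Fin n) {a b} → Sq._≈_ n a b → Free i a → Free i b
  Free-cong {suc n} zero    (_ , q) f       = Sq.trans n (Sq.sym n q) f
  Free-cong {suc n} (suc i) (p , q) (f , g) = Free-cong i p f , Free-cong i q g

  module _ (n : ℕ) where
    private
      module S = Sq n

    lift-* : ∀ (g a b : S.Carrier) →
                       Sq._≈_ (suc n) (Sq._*_ (suc n) (g , S.0#) (a , b)) (g S.* a , g S.* b)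
    lift-* g a b = S.refl , S.trans (S.+-congˡ (S.zeroˡ a)) (S.+-identityʳ _)

    ε-* : ∀ (a b : S.Carrier) →
                       Sq._≈_ (suc n) (Sq._*_ (suc n) (S.0# , S.1#) (a , b)) (S.0# , a)
    ε-* a b = S.zeroˡ a ,
      S.trans (S.+-cong (S.zeroˡ b) (S.*-identityˡ a)) (S.+-identityˡ a)

  Free-gen-* : ∀ {n} (i j : Fin n) → i ≢ j → ∀ b → Free i b → Free i (Sq._*_ n (gen j) b)
  Free-gen-* {suc n} zero    zero    i≢j b        f       = contradiction ≡.refl i≢j
  Free-gen-* {suc n} zero    (suc j) i≢j (a , b)  f       =
    Sq.trans n (proj₂ (lift-* n (gen j) a b)) (Sq.trans n (Sq.*-congˡ n f) (Sq.zeroʳ n _))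
  Free-gen-* {suc n} (suc i) zero    i≢j (a , b)  (f , g) =
    Free-cong (suc i) (Sq.sym (suc n) (ε-* n a b)) (Free-0 i , f)
  Free-gen-* {suc n} (suc i) (suc j) i≢j (a , b)  (f , g) =
    Free-cong (suc i) (Sq.sym (suc n) (lift-* n (gen j) a b))
      (Free-gen-* i j (i≢j ∘ ≡.cong suc) a f , Free-gen-* i j (i≢j ∘ ≡.cong suc) b g)

  -- On an element free of xᵢ, multiplication by xᵢ moves each coefficient to a different squarefree
  -- monomial; none is lost and none collide.
  total-gen-* : ∀ {n} (i : Fin n) b → Free i b → total n (Sq._*_ n (gen i) b) K.≈ total n b
  total-gen-* {suc n} zero    (a , b) f =
    K.trans (total-cong (suc n) (ε-* n a b))
    (K.trans (K.+-comm _ _) (K.+-congˡ (total-cong n (Sq.sym n f))))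
  total-gen-* {suc n} (suc i) (a , b) (f , g) =
    K.trans (total-cong (suc n) (lift-* n (gen i) a b))
    (K.+-cong (total-gen-* i a f) (total-gen-* i b g))

  gen-square : ∀ {n} (i : Fin n) → Sq._≈_ n (Sq._*_ n (gen i) (gen i)) (Sq.0# n)
  gen-square {suc n} zero    = Sq.trans (suc n) (ε-* n (Sq.0# n) (Sq.1# n)) (Sq.refl (suc n))
  gen-square {suc n} (suc i) = Sq.trans (suc n) (lift-* n (gen i) (gen i) (Sq.0# n)) (gen-square i , Sq.zeroʳ n _)

  monomial : Vec (Fin n) k → Sq.Carrier n
  monomial {n} []       = Sq.1# n
  monomial {n} (i ∷ is) = Sq._*_ n (gen i) (monomial is)

  Free-monomial : ∀ (i : Fin n) {is : Vec (Fin n) k} → All (i ≢_) is → Free i (monomial is)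
  Free-monomial i []        = Free-1 i
  Free-monomial i {j ∷ js} (i≢j ∷ i∉js) = Free-gen-* i j i≢j (monomial js) (Free-monomial i i∉js)

  total-monomial-unique : {is : Vec (Fin n) k} → Unique is → total n (monomial is) K.≈ K.1#
  total-monomial-unique {n} []         = total-1 n
  total-monomial-unique {n} {is = i ∷ is} (i∉is ∷ u) =
    K.trans (total-gen-* i (monomial is) (Free-monomial i i∉is)) (total-monomial-unique u)

  -- The factor xᵢ is commuted to the right until it meets its other occurrence, where xᵢ² = 0
  -- applies.
  gen-*-monomial-repeated : ∀ (i : Fin n) (is : Vec (Fin n) k) → ¬ All (i ≢_) is →
                            Sq._≈_ n (Sq._*_ n (gen i) (monomial is)) (Sq.0# n)
  gen-*-monomial-repeated {n} i []       i∈is = contradiction [] i∈is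
  gen-*-monomial-repeated {n} i (j ∷ js) i∈is with i Fin.≟ j
  ... | yes ≡.refl = S.trans (S.sym (S.*-assoc _ _ _)) (S.trans (S.*-congʳ (gen-square i)) (S.zeroˡ _))
    where module S = Sq n
  ... | no i≢j     = S.trans (x∙yz≈y∙xz _ _ _)
      (S.trans (S.*-congˡ (gen-*-monomial-repeated i js (i∈is ∘ (i≢j ∷_)))) (S.zeroʳ _))
    where
    module S = Sq n
    open CommutativeSemigroupProperties S.*-commutativeSemigroup using (x∙yz≈y∙xz)

  monomial-repeated : ∀ (is : Vec (Fin n) k) → ¬ Unique is → Sq._≈_ n (monomial is) (Sq.0# n)
  monomial-repeated {n} []       ¬u = contradiction [] ¬u
  monomial-repeated {n} (i ∷ is) ¬u with All.all? (λ j → ¬? (i Fin.≟ j)) is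
  ... | yes i∉is = Sq.trans n (Sq.*-congˡ n (monomial-repeated is (¬u ∘ (i∉is ∷_)))) (Sq.zeroʳ n _)
  ... | no  i∈is = gen-*-monomial-repeated i is i∈is

  module _ (R : RawRing c′ ℓ′) {f : ∣ R ∣ → K.Carrier} (f-isHom : IsHom R K.rawRing f) where

    reduce : ∀ n → ∣ R [X^ n ] ∣ → Sq.Carrier n
    reduce zero    p = f p
    reduce (suc n) p = reduce n (coeff (R [X^ n ]) p 0) , reduce n (coeff (R [X^ n ]) p 1)

    -- Coefficients 0 and 1 of a product of series involve only coefficients 0 and 1 of the factors,
    -- and combine exactly as dual numbers do.
    reduce-isHom : ∀ n → IsHom (R [X^ n ]) (Sq.rawRing n) (reduce n)
    reduce-isHom zero    = f-isHom
    reduce-isHom (suc n) = record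
      { cong    = λ p → H.cong (p 0) , H.cong (p 1)
      ; +-homo  = λ p q → H.+-homo p q 0 , H.+-homo p q 1
      ; *-homo  = λ p q → S.trans (H.*-homo p q 0) (S.+-identityʳ _)
                        , S.trans (H.*-homo p q 1) (S.+-congˡ (S.+-identityʳ _))
      ; -‿homo  = λ p → H.-‿homo p 0 , H.-‿homo p 1
      ; 0#-homo = H.0#-homo 0 , H.0#-homo 1
      ; 1#-homo = H.1#-homo 0 , H.1#-homo 1
      }
      where
      module S = Sq n
      module H where
        open IsHom (reduce-isHom n) using (cong) public
        open IsHom (poly-isHom (R [X^ n ]) (squarefreeRing n) (reduce-isHom n)) hiding (cong) public

    reduce-const : ∀ n a → Sq._≈_ n (reduce n (const R n a)) (scalar n (f a))
    reduce-const zero    a = K.refl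
    reduce-const (suc n) a = reduce-const n a , IsHom.0#-homo (reduce-isHom n)

    reduce-var : ∀ (i : Fin n) → Sq._≈_ n (reduce n (var R i)) (gen i)
    reduce-var {suc n} zero    = IsHom.0#-homo (reduce-isHom n) , IsHom.1#-homo (reduce-isHom n)
    reduce-var {suc n} (suc i) = reduce-var i , IsHom.0#-homo (reduce-isHom n)

    -- The exponent vectors are enumerated with outermost exponent 0 first and then 1, which is the
    -- splitting made by `total`.
    sq-reduce : ∀ n p → f (sq {n = n} R p) K.≈ total n (reduce n p)
    sq-reduce n p = K.trans (listSum-homo R K f-isHom (vecsOver (0 ∷ 1 ∷ []) n) (coeffAt R p)) (go n p)
      where
      go : ∀ n p → listSum K.rawRing (vecsOver (0 ∷ 1 ∷ []) n) (f ∘ coeffAt R p) K.≈ total n (reduce n p)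
      go zero    p = K.+-identityʳ _
      go (suc n) p = begin
        Σ (List.map (0 ∷_) αs ++ List.map (1 ∷_) αs ++ []) g
          ≈⟨ listSum-++ K (List.map (0 ∷_) αs) _ g ⟩
        Σ (List.map (0 ∷_) αs) g K.+ Σ (List.map (1 ∷_) αs ++ []) g
          ≈⟨ K.+-congˡ (K.trans (listSum-++ K (List.map (1 ∷_) αs) [] g) (K.+-identityʳ _)) ⟩
        Σ (List.map (0 ∷_) αs) g K.+ Σ (List.map (1 ∷_) αs) g
          ≈⟨ K.+-cong (K.trans (listSum-map K (0 ∷_) αs g) (go n _)) (K.trans (listSum-map K (1 ∷_) αs g) (go n _)) ⟩
        total (suc n) (reduce (suc n) p) ∎
        where
        open SetoidReasoning K.setoid
        αs = vecsOver (0 ∷ 1 ∷ []) n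
        g  = f ∘ coeffAt R p
        Σ : {A : Set} → List A → (A → K.Carrier) → K.Carrier
        Σ = listSum K.rawRing

  module _ (R : RawRing c′ ℓ′) (R′ : RawRing c″ ℓ″) {f : ∣ R ∣ → K.Carrier} {f′ : ∣ R′ ∣ → K.Carrier}
           (f-isHom : IsHom R K.rawRing f) (f′-isHom : IsHom R′ K.rawRing f′)
           (g : ∣ R ∣ → ∣ R′ ∣) (f′∘g≈f : ∀ a → f′ (g a) K.≈ f a) where

    -- This bridges the two coefficient rings: the determinant is formed over ℤ[w,r] and its
    -- logarithm over ℚ[w,r], but both reduce into the same algebra.
    reduce-mapCoeffs : ∀ n p → Sq._≈_ n (reduce R′ f′-isHom n (mapCoeffs R R′ n g p)) (reduce R f-isHom n p)
    reduce-mapCoeffs zero    p = f′∘g≈f p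
    reduce-mapCoeffs (suc n) p = go p 0 , go p 1
      where
      go : ∀ p k → Sq._≈_ n (reduce R′ f′-isHom n (coeff (R′ [X^ n ]) (mapCoeffs R R′ (suc n) g p) k))
                            (reduce R f-isHom n (coeff (R [X^ n ]) p k))
      go []      k       = Sq.trans n (IsHom.0#-homo (reduce-isHom R′ f′-isHom n))
                                      (Sq.sym n (IsHom.0#-homo (reduce-isHom R f-isHom n)))
      go (a ∷ p) zero    = reduce-mapCoeffs n a
      go (a ∷ p) (suc k) = go p k

-- Determinants

module _ (S : CommutativeRing c ℓ) where
  open CommutativeRing S hiding (zero)
  open SemiringSum semiring using (sum; sum-cong-≋; sum-remove; sum-replicate-zero;
    ∑-distrib-+; ∑-comm; *-distribˡ-sum; *-distribʳ-sum)
  open SemiringExp semiring using (_^_)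
  open RingProperties ring using (-1*x≈-x; -‿distribˡ-*; -‿distribʳ-*)
  open AbelianGroupProperties +-abelianGroup using (⁻¹-involutive; identityˡ-unique; inverseʳ-unique)
  open SetoidReasoning setoid
  open SemiringSolver commutativeSemiring using (solve; _:+_; _:*_; _:=_; con)
  private
    Mat : ℕ → Set c
    Mat = Matrix rawRing
    Det : Mat n → Carrier
    Det = det rawRing

  sum-zero : ∀ {n} (f : Fin n → Carrier) → (∀ i → f i ≈ 0#) → sum f ≈ 0#
  sum-zero {n} f eq = trans (sum-cong-≋ eq) (sum-replicate-zero n)

  sum-single : ∀ {n} (i : Fin n) (f : Fin n → Carrier) → (∀ l → l ≢ i → f l ≈ 0#) → sum f ≈ f i
  sum-single {suc n} i f eq = begin
    sum f                        ≈⟨ sum-remove {i = i} f ⟩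
    f i + sum (f ∘ punchIn i)    ≈⟨ +-congˡ (sum-zero (f ∘ punchIn i) (λ l → eq _ (Fin.punchInᵢ≢i i l))) ⟩
    f i + 0#                     ≈⟨ +-identityʳ _ ⟩
    f i                          ∎

  sgn : Fin n → Carrier
  sgn j = (- 1#) ^ toℕ j

  minor : Mat (suc n) → Fin (suc n) → Mat n
  minor A j i l = A (suc i) (punchIn j l)

  det-identity : ∀ n → Det (identity rawRing {n}) ≈ 1#
  det-identity zero    = refl
  det-identity (suc n) = begin
    sum term              ≈⟨ sum-single zero term off-diagonal ⟩
    1# * (1# * Det (identity rawRing {n})) ≈⟨ *-identityˡ _ ⟩
    1# * Det (identity rawRing {n})        ≈⟨ *-identityˡ _ ⟩
    Det (identity rawRing {n})             ≈⟨ det-identity n ⟩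
    1#                    ∎
    where
    term : Fin (suc n) → Carrier
    term j = sgn j * (identity rawRing zero j * Det (minor (identity rawRing) j))
    off-diagonal : ∀ j → j ≢ zero → term j ≈ 0#
    off-diagonal zero    j≢0 = contradiction ≡.refl j≢0
    off-diagonal (suc j) _   = trans (*-congˡ (zeroˡ _)) (zeroʳ _)

  -- Row 0 enters the Laplace expansion linearly, and any other row does so by induction inside the
  -- minors. A whole linear combination is treated at once because a row of a matrix product has
  -- this shape.
  det-row-linear : ∀ (i : Fin n) (A : Fin m → Mat n) (a : Fin m → Carrier) (B : Mat n) →
                   (∀ s r → r ≢ i → ∀ j → B r j ≈ A s r j) →
                   (∀ j → B i j ≈ sum (λ s → a s * A s i j)) →
                   Det B ≈ sum (λ s → a s * Det (A s))
  det-row-linear {suc n} {m} i A a B off on = begin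
    sum (term B)                                 ≈⟨ sum-cong-≋ (expand i off on) ⟩
    sum (λ j → sum (λ s → a s * term (A s) j))   ≈⟨ ∑-comm (λ j s → a s * term (A s) j) ⟩
    sum (λ s → sum (λ j → a s * term (A s) j))   ≈⟨ sum-cong-≋ (λ s → *-distribˡ-sum (a s) (term (A s))) ⟨
    sum (λ s → a s * sum (term (A s)))           ∎
    where
    term : Mat (suc n) → Fin (suc n) → Carrier
    term M j = sgn j * (M zero j * Det (minor M j))
    expand : ∀ i → (∀ s r → r ≢ i → ∀ j → B r j ≈ A s r j) →
             (∀ j → B i j ≈ sum (λ s → a s * A s i j)) →
             ∀ j → term B j ≈ sum (λ s → a s * term (A s) j)
    expand zero off on j = begin
      sgn j * (B zero j * D)
        ≈⟨ *-congˡ (*-congʳ (on j)) ⟩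
      sgn j * (sum (λ s → a s * A s zero j) * D)
        ≈⟨ *-congˡ (*-distribʳ-sum D (λ s → a s * A s zero j)) ⟩
      sgn j * sum (λ s → a s * A s zero j * D)
        ≈⟨ *-distribˡ-sum (sgn j) (λ s → a s * A s zero j * D) ⟩
      sum (λ s → sgn j * (a s * A s zero j * D))
        ≈⟨ sum-cong-≋ (λ s → trans
             (solve 4 (λ e a x d → e :* (a :* x :* d) := a :* (e :* (x :* d))) refl (sgn j) (a s) (A s zero j) D)
             (*-congˡ (*-congˡ (*-congˡ (det-cong S (λ r l → off s (suc r) (λ ()) (punchIn j l))))))) ⟩
      sum (λ s → a s * term (A s) j) ∎
      where D = Det (minor B j)
    expand (suc i) off on j = begin
      sgn j * (B zero j * Det (minor B j))
        ≈⟨ *-congˡ (*-congˡ (det-row-linear i (λ s → minor (A s) j) a (minor B j)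
             (λ s r r≢i l → off s (suc r) (r≢i ∘ Fin.suc-injective) (punchIn j l))
             (λ l → on (punchIn j l)))) ⟩
      sgn j * (B zero j * sum (λ s → a s * Det (minor (A s) j)))
        ≈⟨ *-congˡ (*-distribˡ-sum (B zero j) (λ s → a s * Det (minor (A s) j))) ⟩
      sgn j * sum (λ s → B zero j * (a s * Det (minor (A s) j)))
        ≈⟨ *-distribˡ-sum (sgn j) (λ s → B zero j * (a s * Det (minor (A s) j))) ⟩
      sum (λ s → sgn j * (B zero j * (a s * Det (minor (A s) j))))
        ≈⟨ sum-cong-≋ (λ s → trans
             (solve 4 (λ e a x d → e :* (x :* (a :* d)) := a :* (e :* (x :* d))) refl (sgn j) (a s) (B zero j) (Det (minor (A s) j)))
             (*-congˡ (*-congˡ (*-congʳ (off s zero (λ ()) j))))) ⟩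
      sum (λ s → a s * term (A s) j) ∎

  private
    -- In two successive expansions the second column is indexed by its position m after column j
    -- has been deleted, so its true index is `punchIn j m` while its sign is that of m.
    pairTerm : (Fin (suc (suc n)) → Fin (suc (suc n)) → (Fin n → Fin (suc (suc n))) → Carrier) →
               Fin (suc (suc n)) → Fin (suc n) → Carrier
    pairTerm h j m = sgn j * (sgn m * h j (punchIn j m) (punchIn j ∘ punchIn m))

    pairSum : (Fin (suc (suc n)) → Fin (suc (suc n)) → (Fin n → Fin (suc (suc n))) → Carrier) → Carrier
    pairSum h = sum (λ j → sum (pairTerm h j))

    lift : (Fin n → Fin m) → Fin (suc n) → Fin (suc m)
    lift e zero    = zero
    lift e (suc l) = suc (e l)

    lift-cong : {e e′ : Fin n → Fin m} → (∀ l → e l ≡ e′ l) → ∀ l → lift e l ≡ lift e′ l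
    lift-cong eq zero    = ≡.refl
    lift-cong eq (suc l) = ≡.cong suc (eq l)

  -- The ordered pairs of columns (j, j′) and (j′, j) occur with opposite signs in
  -- a double Laplace expansion; e enumerates the remaining columns.
  pairSum-cancel : ∀ {n} h → (∀ j j′ e → h j j′ e ≈ h j′ j e) →
                   (∀ j j′ {e e′} → (∀ l → e l ≡ e′ l) → h j j′ e ≈ h j j′ e′) →
                   pairSum {n} h ≈ 0#
  pairSum-cancel {n} h h-sym h-ext = begin
    sum X + sum (λ j → Y j + Z j)
      ≈⟨ +-congˡ (∑-distrib-+ Y Z) ⟩
    sum X + (sum Y + sum Z)
      ≈⟨ +-congˡ (+-congˡ (Z-cancel n h h-sym h-ext)) ⟩
    sum X + (sum Y + 0#)
      ≈⟨ +-congˡ (+-identityʳ _) ⟩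
    sum X + sum Y
      ≈⟨ ∑-distrib-+ X Y ⟨
    sum (λ j → X j + Y j)
      ≈⟨ sum-zero (λ j → X j + Y j) XY-cancel ⟩
    0# ∎
    where
    -- The ordered pairs are sorted by the role of column 0: chosen first (X), chosen second (Y), or
    -- not chosen (Z). X and Y cancel term by term.
    X Y Z : Fin (suc n) → Carrier
    X m = pairTerm h zero m
    Y j = pairTerm h (suc j) zero
    Z j = sum (λ m → pairTerm h (suc j) (suc m))
    XY-cancel : ∀ j → X j + Y j ≈ 0#
    XY-cancel j = begin
      1# * (sgn j * a) + (- 1# * sgn j) * (1# * b)
        ≈⟨ +-cong (*-identityˡ _) (trans (*-cong (-1*x≈-x _) (*-identityˡ _)) (*-congˡ (h-sym (suc j) zero _))) ⟩
      sgn j * a + - sgn j * a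
        ≈⟨ distribʳ _ _ _ ⟨
      (sgn j + - sgn j) * a
        ≈⟨ trans (*-congʳ (-‿inverseʳ _)) (zeroˡ _) ⟩
      0# ∎
      where
      a = h zero (suc j) (suc ∘ punchIn j)
      b = h (suc j) zero (suc ∘ punchIn j)
    -- When column 0 is not chosen, dropping it changes both signs, hence not their product. This
    -- leaves a smaller instance in which `lift` keeps column 0 among the remaining columns.
    Z-cancel : ∀ n h → (∀ j j′ e → h j j′ e ≈ h j′ j e) →
               (∀ j j′ {e e′} → (∀ l → e l ≡ e′ l) → h j j′ e ≈ h j j′ e′) →
               sum {suc n} (λ j → sum (λ m → pairTerm h (suc j) (suc m))) ≈ 0#
    Z-cancel zero    h h-sym h-ext = +-identityʳ _
    Z-cancel (suc n) h h-sym h-ext = trans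
      (sum-cong-≋ (λ j → sum-cong-≋ (λ m → begin
        - 1# * sgn j * (- 1# * sgn m * h (suc j) (suc (punchIn j m)) (punchIn (suc j) ∘ punchIn (suc m)))
          -- The two enumerations of the remaining columns agree only pointwise, which is why `h` is
          -- assumed extensional.
          ≈⟨ *-cong (-1*x≈-x _) (*-cong (-1*x≈-x _) (h-ext _ _ (λ { zero → ≡.refl ; (suc l) → ≡.refl }))) ⟩
        - sgn j * (- sgn m * h′ j (punchIn j m) (punchIn j ∘ punchIn m))
          ≈⟨ *-congˡ (-‿distribˡ-* _ _) ⟨
        - sgn j * - (sgn m * h′ j (punchIn j m) (punchIn j ∘ punchIn m))
          ≈⟨ trans (sym (-‿distribˡ-* _ _)) (-‿cong (sym (-‿distribʳ-* _ _))) ⟩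
        - - (sgn j * (sgn m * h′ j (punchIn j m) (punchIn j ∘ punchIn m)))
          ≈⟨ ⁻¹-involutive _ ⟩
        pairTerm h′ j m ∎)))
      (pairSum-cancel h′ (λ j j′ e → h-sym _ _ _) (λ j j′ eq → h-ext _ _ (lift-cong eq)))
      where
      h′ : Fin (suc (suc n)) → Fin (suc (suc n)) → (Fin n → Fin (suc (suc n))) → Carrier
      h′ j j′ e = h (suc j) (suc j′) (lift e)

  private
    pairMinor : Mat (suc (suc n)) → Fin (suc (suc n)) → Fin (suc (suc n)) → (Fin n → Fin (suc (suc n))) → Carrier
    pairMinor A j j′ e = A zero j * (A (suc zero) j′ * Det (λ i l → A (suc (suc i)) (e l)))

    pairMinor-ext : (A : Mat (suc (suc n))) → ∀ j j′ {e e′} → (∀ l → e l ≡ e′ l) → pairMinor A j j′ e ≈ pairMinor A j j′ e′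
    pairMinor-ext A j j′ eq = *-congˡ (*-congˡ (det-cong S (λ i l → reflexive (≡.cong (A (suc (suc i))) (eq l)))))

  det-double-expansion : (A : Mat (suc (suc n))) → Det A ≈ pairSum (pairMinor A)
  det-double-expansion A = sum-cong-≋ (λ j → *-congˡ {sgn j} (begin
    A zero j * sum (f j)
      ≈⟨ *-distribˡ-sum (A zero j) (f j) ⟩
    sum (λ m → A zero j * f j m)
      ≈⟨ sum-cong-≋ (λ m → solve 4 (λ x e y d → x :* (e :* (y :* d)) := e :* (x :* (y :* d)))
           refl (A zero j) (sgn m) (A (suc zero) (punchIn j m)) (Det (minor (minor A j) m))) ⟩
    sum (λ m → sgn m * pairMinor A j (punchIn j m) (punchIn j ∘ punchIn m)) ∎)
    ⟨ trans ⟩ *-distribˡ-sum (sgn j) (λ m → sgn m * pairMinor A j (punchIn j m) (punchIn j ∘ punchIn m)))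
    where
    f : ∀ j m → Carrier
    f j m = sgn m * (A (suc zero) (punchIn j m) * Det (minor (minor A j) m))

  -- The adjacent transposition of i and i + 1.
  swapAt : Fin n → Fin (suc n) → Fin (suc n)
  swapAt zero    zero          = suc zero
  swapAt zero    (suc zero)    = zero
  swapAt zero    (suc (suc r)) = suc (suc r)
  swapAt (suc i) zero          = zero
  swapAt (suc i) (suc r)       = suc (swapAt i r)

  swapAt-inject₁ : (i : Fin n) → swapAt i (inject₁ i) ≡ suc i
  swapAt-inject₁ zero    = ≡.refl
  swapAt-inject₁ (suc i) = ≡.cong suc (swapAt-inject₁ i)

  -- For the first two rows, adding the swapped double expansion makes the summand symmetric in the
  -- two columns, so `pairSum-cancel` applies. Lower rows follow by induction in the minors.
  det-swap : (i : Fin n) (A : Mat (suc n)) → Det A + Det (A ∘ swapAt i) ≈ 0#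
  det-swap zero A = begin
    Det A + Det A′
      ≈⟨ +-cong (det-double-expansion A) (det-double-expansion A′) ⟩
    pairSum (pairMinor A) + pairSum (pairMinor A′)
      ≈⟨ ∑-distrib-+ (λ j → sum (pairTerm (pairMinor A) j)) (λ j → sum (pairTerm (pairMinor A′) j)) ⟨
    sum (λ j → sum (pairTerm (pairMinor A) j) + sum (pairTerm (pairMinor A′) j))
      ≈⟨ sum-cong-≋ (λ j → trans (sym (∑-distrib-+ (pairTerm (pairMinor A) j) (pairTerm (pairMinor A′) j)))
           (sum-cong-≋ (pairTerm-+ j))) ⟩
    pairSum h
      ≈⟨ pairSum-cancel h h-sym (λ j j′ eq → +-cong (pairMinor-ext A j j′ eq) (pairMinor-ext A′ j j′ eq)) ⟩
    0# ∎
    where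
    A′ = A ∘ swapAt zero
    h = λ j j′ e → pairMinor A j j′ e + pairMinor A′ j j′ e
    pairTerm-+ : ∀ j m → pairTerm (pairMinor A) j m + pairTerm (pairMinor A′) j m ≈ pairTerm h j m
    pairTerm-+ j m = trans (sym (distribˡ _ _ _)) (*-congˡ (sym (distribˡ _ _ _)))
    h-sym : ∀ j j′ e → h j j′ e ≈ h j′ j e
    h-sym j j′ e = solve 5 (λ x y x′ y′ d → x :* (y′ :* d) :+ y :* (x′ :* d) := x′ :* (y :* d) :+ y′ :* (x :* d))
      refl (A zero j) (A (suc zero) j) (A zero j′) (A (suc zero) j′) (Det (λ i l → A (suc (suc i)) (e l)))
  det-swap {suc n} (suc i) A = begin
    sum (term A) + sum (term A′)
      ≈⟨ ∑-distrib-+ (term A) (term A′) ⟨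
    sum (λ j → term A j + term A′ j)
      ≈⟨ sum-zero (λ j → term A j + term A′ j) (λ j → begin
           sgn j * (A zero j * Det (minor A j)) + sgn j * (A zero j * Det (minor A j ∘ swapAt i))
             ≈⟨ solve 4 (λ e x d d′ → e :* (x :* d) :+ e :* (x :* d′) := e :* (x :* (d :+ d′)))
                  refl (sgn j) (A zero j) (Det (minor A j)) (Det (minor A j ∘ swapAt i)) ⟩
           sgn j * (A zero j * (Det (minor A j) + Det (minor A j ∘ swapAt i)))
             ≈⟨ *-congˡ (*-congˡ (det-swap i (minor A j))) ⟩
           sgn j * (A zero j * 0#)
             ≈⟨ trans (*-congˡ (zeroʳ _)) (zeroʳ _) ⟩
           0# ∎) ⟩
    0# ∎
    where
    A′ = A ∘ swapAt (suc i)
    term : Mat (suc (suc n)) → Fin (suc (suc n)) → Carrier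
    term M j = sgn j * (M zero j * Det (minor M j))

  -- For equal rows `det-swap` alone yields only 2 det A = 0. Rows 0 and 1 are therefore handled by
  -- `pairSum-cancel` directly, and a lower row is brought up by adjacent transpositions that leave
  -- row 0 in place.
  det-equal-zero-suc : (s : Fin n) (A : Mat (suc n)) → (∀ j → A zero j ≈ A (suc s) j) → Det A ≈ 0#
  det-equal-zero-suc {suc n} = <-weakInduction
    (λ s → ∀ A → (∀ j → A zero j ≈ A (suc s) j) → Det A ≈ 0#)
    (λ A eq → trans (det-double-expansion A) (pairSum-cancel (pairMinor A)
      (λ j j′ e → trans (*-cong (eq j) (*-congʳ (sym (eq j′)))) (solve 3 (λ y x d → y :* (x :* d) := x :* (y :* d)) refl
        (A (suc zero) j) (A zero j′) (Det (λ i l → A (suc (suc i)) (e l)))))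
      (pairMinor-ext A)))
    (λ s ih A eq → begin
      Det A                               ≈⟨ +-identityʳ _ ⟨
      Det A + 0#                          ≈⟨ +-congˡ (ih (A ∘ swapAt (suc s)) (λ j → trans (eq j)
                                               (reflexive (≡.cong (λ r → A (suc r) j) (≡.sym (swapAt-inject₁ s)))))) ⟨
      Det A + Det (A ∘ swapAt (suc s))    ≈⟨ det-swap (suc s) A ⟩
      0#                                  ∎)

  det-equal-rows : (r s : Fin n) → r ≢ s → (A : Mat n) → (∀ j → A r j ≈ A s j) → Det A ≈ 0#
  det-equal-rows zero    zero    r≢s A eq = contradiction ≡.refl r≢s
  det-equal-rows zero    (suc s) r≢s A eq = det-equal-zero-suc s A eq
  det-equal-rows (suc r) zero    r≢s A eq = det-equal-zero-suc r A (sym ∘ eq)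
  det-equal-rows (suc r) (suc s) r≢s A eq = sum-zero (λ j → sgn j * (A zero j * Det (minor A j)))
    (λ j → trans (*-congˡ (trans (*-congˡ (det-equal-rows r s (r≢s ∘ ≡.cong suc) (minor A j)
      (λ l → eq (punchIn j l)))) (zeroʳ _))) (zeroʳ _))

  replaceRow : Fin n → (Fin n → Fin m → Carrier) → (Fin n → Fin m → Carrier) → Fin n → Fin m → Carrier
  replaceRow i B A r j = if does (i Fin.≟ r) then B r j else A r j

  replaceRow-on : ∀ (i : Fin n) (B A : Fin n → Fin m → Carrier) j → replaceRow i B A i j ≡ B i j
  replaceRow-on i B A j = ≡.cong (if_then B i j else A i j) (dec-true (i Fin.≟ i) ≡.refl)

  replaceRow-off : ∀ (i : Fin n) (B A : Fin n → Fin m → Carrier) {r} → r ≢ i → ∀ j → replaceRow i B A r j ≡ A r j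
  replaceRow-off i B A {r} r≢i j = ≡.cong (if_then B r j else A r j) (dec-false (i Fin.≟ r) (r≢i ∘ ≡.sym))

  -- Expanding row i by linearity, the term for s ≠ i contains row s twice and vanishes.
  det-replaceRow : (i : Fin n) (A B : Mat n) (a : Fin n → Carrier) →
                   (∀ j → B i j ≈ sum (λ l → a l * A l j)) → Det (replaceRow i B A) ≈ a i * Det A
  det-replaceRow {n} i A B a eq = begin
    Det (replaceRow i B A)
      ≈⟨ det-row-linear i C a (replaceRow i B A)
           (λ s r r≢i j → reflexive (≡.trans (replaceRow-off i B A r≢i j) (≡.sym (replaceRow-off i (λ _ → A s) A r≢i j))))
           (λ j → trans (reflexive (replaceRow-on i B A j)) (trans (eq j)
             (sum-cong-≋ (λ s → *-congˡ {a s} (reflexive (≡.sym (replaceRow-on i (λ _ → A s) A j))))))) ⟩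
    sum (λ s → a s * Det (C s))
      ≈⟨ sum-single i (λ s → a s * Det (C s)) (λ s s≢i → trans (*-congˡ
           (det-equal-rows i s (s≢i ∘ ≡.sym) (C s) (λ j → reflexive
             (≡.trans (replaceRow-on i (λ _ → A s) A j) (≡.sym (replaceRow-off i (λ _ → A s) A s≢i j)))))) (zeroʳ _)) ⟩
    a i * Det (C i)
      ≈⟨ *-congˡ (det-cong S same) ⟩
    a i * Det A ∎
    where
    C : Fin n → Mat n
    C s = replaceRow i (λ _ → A s) A
    same : ∀ r j → C i r j ≈ A r j
    same r j with i Fin.≟ r
    ... | yes ≡.refl = refl
    ... | no _       = refl

  -- Derivations and Jacobi's formula

  record IsDerivation (δ : Carrier → Carrier) : Set (c ⊔ ℓ) where
    field
      δ-cong  : ∀ {x y} → x ≈ y → δ x ≈ δ y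
      δ-+     : ∀ x y → δ (x + y) ≈ δ x + δ y
      leibniz : ∀ x y → δ (x * y) ≈ δ x * y + x * δ y

    δ-0 : δ 0# ≈ 0#
    δ-0 = identityˡ-unique _ _ (trans (sym (δ-+ 0# 0#)) (δ-cong (+-identityˡ _)))

    δ-1 : δ 1# ≈ 0#
    δ-1 = identityˡ-unique _ _ (begin
      δ 1# + δ 1#            ≈⟨ +-cong (*-identityʳ _) (*-identityˡ _) ⟨
      δ 1# * 1# + 1# * δ 1#  ≈⟨ leibniz _ _ ⟨
      δ (1# * 1#)            ≈⟨ δ-cong (*-identityˡ _) ⟩
      δ 1#                   ∎)

    δ-neg : ∀ x → δ (- x) ≈ - δ x
    δ-neg x = inverseʳ-unique _ _ (trans (sym (δ-+ x (- x))) (trans (δ-cong (-‿inverseʳ x)) δ-0))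

    δ-sum : ∀ {n} (f : Fin n → Carrier) → δ (sum f) ≈ sum (δ ∘ f)
    δ-sum {zero}  f = δ-0
    δ-sum {suc n} f = trans (δ-+ _ _) (+-congˡ (δ-sum (f ∘ suc)))

    δ-sgn : ∀ k → δ ((- 1#) ^ k) ≈ 0#
    δ-sgn zero    = δ-1
    δ-sgn (suc k) = begin
      δ (- 1# * (- 1#) ^ k)                          ≈⟨ leibniz _ _ ⟩
      δ (- 1#) * (- 1#) ^ k + - 1# * δ ((- 1#) ^ k)  ≈⟨ +-cong (*-congʳ (trans (δ-neg 1#) (trans (-‿cong δ-1) -0#≈0#))) (*-congˡ (δ-sgn k)) ⟩
      0# * (- 1#) ^ k + - 1# * 0#                    ≈⟨ +-cong (zeroˡ _) (zeroʳ _) ⟩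
      0# + 0#                                        ≈⟨ +-identityˡ _ ⟩
      0#                                             ∎
      where open RingProperties ring using (-0#≈0#)

    δ-det : (A : Mat n) → δ (Det A) ≈ sum (λ i → Det (replaceRow i (λ r j → δ (A r j)) A))
    δ-det {zero}  A = δ-1
    δ-det {suc n} A = begin
      δ (sum (λ j → sgn j * (A zero j * D j)))
        ≈⟨ δ-sum (λ j → sgn j * (A zero j * D j)) ⟩
      sum (λ j → δ (sgn j * (A zero j * D j)))
        ≈⟨ sum-cong-≋ step ⟩
      sum (λ j → term zero j + sum (λ i → term (suc i) j))
        ≈⟨ ∑-distrib-+ (term zero) (λ j → sum (λ i → term (suc i) j)) ⟩
      sum (term zero) + sum (λ j → sum (λ i → term (suc i) j))
        ≈⟨ +-congˡ (∑-comm (λ j i → term (suc i) j)) ⟩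
      sum (term zero) + sum (λ i → sum (term (suc i))) ∎
      where
      δA : Mat (suc n)
      δA r j = δ (A r j)
      D : Fin (suc n) → Carrier
      D j = Det (minor A j)
      term : Fin (suc n) → Fin (suc n) → Carrier
      term i j = sgn j * (replaceRow i δA A zero j * Det (minor (replaceRow i δA A) j))
      step : ∀ j → δ (sgn j * (A zero j * D j)) ≈ term zero j + sum (λ i → term (suc i) j)
      step j = begin
        δ (sgn j * (A zero j * D j))
          ≈⟨ leibniz _ _ ⟩
        δ (sgn j) * (A zero j * D j) + sgn j * δ (A zero j * D j)
          ≈⟨ +-cong (trans (*-congʳ (δ-sgn (toℕ j))) (zeroˡ _)) (*-congˡ (leibniz _ _)) ⟩
        0# + sgn j * (δA zero j * D j + A zero j * δ (D j))
          ≈⟨ trans (+-identityˡ _) (distribˡ _ _ _) ⟩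
        -- `replaceRow` computes on row 0 and commutes definitionally with `minor`, so the
        -- derivative of the first row is already the summand for i = 0 and the minors supply the
        -- others.
        term zero j + sgn j * (A zero j * δ (D j))
          ≈⟨ +-congˡ (*-congˡ (trans (*-congˡ (δ-det (minor A j))) (*-distribˡ-sum (A zero j) (E j)))) ⟩
        term zero j + sgn j * sum (λ i → A zero j * E j i)
          ≈⟨ +-congˡ (*-distribˡ-sum (sgn j) (λ i → A zero j * E j i)) ⟩
        term zero j + sum (λ i → term (suc i) j) ∎
        where
        E : Fin (suc n) → Fin n → Carrier
        E j i = Det (replaceRow i (λ r l → δ (minor A j r l)) (minor A j))

    -- Jacobi's formula in the form δA = CA ⇒ δ(det A) = tr C · det A.
    jacobi : (A C : Mat n) → (∀ i j → δ (A i j) ≈ sum (λ l → C i l * A l j)) →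
             δ (Det A) ≈ sum (λ i → C i i) * Det A
    jacobi A C eq = begin
      δ (Det A)                                              ≈⟨ δ-det A ⟩
      sum (λ i → Det (replaceRow i (λ r j → δ (A r j)) A))   ≈⟨ sum-cong-≋ (λ i → det-replaceRow i A _ (C i) (eq i)) ⟩
      sum (λ i → C i i * Det A)                              ≈⟨ *-distribʳ-sum (Det A) (λ i → C i i) ⟨
      sum (λ i → C i i) * Det A                              ∎

-- Logarithmic derivatives of determinants

module _ (A : CommutativeRing c ℓ) where
  open CommutativeRing A hiding (zero)
  private
    module T where
      open CommutativeRing (seriesRing A) public
      open SemiringExp (CommutativeRing.semiring (seriesRing A)) public using (_^_; ^-congˡ)
      open SemiringMult (CommutativeRing.semiring (seriesRing A)) public using () renaming (_×_ to _·_)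
      open SemiringSum (CommutativeRing.semiring (seriesRing A)) public using (sum)
      open SetoidReasoning (CommutativeRing.setoid (seriesRing A)) public
  open SemiringMult semiring using (×-congʳ; ×-comm-*) renaming (_×_ to _·_)
  open CommutativeMonoidMult +-commutativeMonoid using (×-distrib-+)
  open SemiringExp semiring using (_^_)
  open SemiringSum semiring using (sum; sum-cong-≋; ∑-distrib-+; *-distribˡ-sum)
  open RingProperties ring using (-0#≈0#; -1*x≈-x; -‿distribˡ-*; -‿distribʳ-*)
  open AbelianGroupProperties +-abelianGroup using (⁻¹-∙-comm; ⁻¹-involutive; inverseʳ-unique)
  open SetoidReasoning setoid
  open SemiringSolver commutativeSemiring using (solve; _:+_; _:*_; _:=_; con)

  ·-0 : ∀ k → k · 0# ≈ 0#
  ·-0 zero    = refl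
  ·-0 (suc k) = trans (+-identityˡ _) (·-0 k)

  ·-neg : ∀ k x → k · (- x) ≈ - (k · x)
  ·-neg zero    x = sym -0#≈0#
  ·-neg (suc k) x = trans (+-congˡ (·-neg k x)) (⁻¹-∙-comm _ _)

  ·-sum : ∀ {n} k (f : Fin n → Carrier) → k · sum f ≈ sum (λ i → k · f i)
  ·-sum {zero}  k f = ·-0 k
  ·-sum {suc n} k f = trans (×-distrib-+ _ _ k) (+-congˡ (·-sum k (f ∘ suc)))

  -- t d/dt
  θ : T.Carrier → T.Carrier
  θ f k = k · f k

  -- Shifting does not commute with θ: θ f ∘ suc is f ∘ suc + θ (f ∘ suc). The extra summand matches
  -- the 1 in the factor k + 1 = 1 + k.
  θ-leibniz : ∀ f g → θ (f T.* g) T.≈ θ f T.* g T.+ f T.* θ g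
  θ-leibniz f g zero    = sym (begin
    (0# * g 0 + 0#) + (f 0 * 0# + 0#) ≈⟨ +-cong (trans (+-identityʳ _) (zeroˡ _)) (trans (+-identityʳ _) (zeroʳ _)) ⟩
    0# + 0#                           ≈⟨ +-identityˡ _ ⟩
    0#                                ∎)
  θ-leibniz f g (suc k) = begin
    suc k · (f 0 * g (suc k) + (f ∘ suc T.* g) k)
      ≈⟨ ×-distrib-+ _ _ (suc k) ⟩
    suc k · (f 0 * g (suc k)) + ((f ∘ suc T.* g) k + k · (f ∘ suc T.* g) k)
      ≈⟨ +-cong (sym (×-comm-* (suc k) (f 0) (g (suc k)))) (+-congˡ (θ-leibniz (f ∘ suc) g k)) ⟩
    f 0 * (suc k · g (suc k)) + ((f ∘ suc T.* g) k + ((θ (f ∘ suc) T.* g) k + (f ∘ suc T.* θ g) k))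
      ≈⟨ solve 5 (λ a b c d z → a :+ (b :+ (c :+ d)) := (con 0 :* z :+ (b :+ c)) :+ (a :+ d)) refl _ _ _ _ (g (suc k)) ⟩
    (0# * g (suc k) + ((f ∘ suc T.* g) k + (θ (f ∘ suc) T.* g) k)) + (f 0 * (suc k · g (suc k)) + (f ∘ suc T.* θ g) k)
      ≈⟨ +-congʳ (+-congˡ (sym (T.distribʳ g (f ∘ suc) (θ (f ∘ suc)) k))) ⟩
    (θ f T.* g T.+ f T.* θ g) (suc k) ∎

  θ-isDerivation : IsDerivation (seriesRing A) θ
  θ-isDerivation = record
    { δ-cong  = λ p k → ×-congʳ k (p k)
    ; δ-+     = λ f g k → ×-distrib-+ (f k) (g k) k
    ; leibniz = θ-leibniz
    }
  open IsDerivation θ-isDerivation using (δ-1; δ-neg; jacobi)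

  series-· : ∀ j f k → (j T.· f) k ≈ j · f k
  series-· zero    f k = refl
  series-· (suc j) f k = +-congˡ (series-· j f k)

  θ-^ : ∀ f j → θ (f T.^ suc j) T.≈ suc j T.· (f T.^ j T.* θ f)
  θ-^ f zero    = T.begin
    θ (f T.* T.1#)       T.≈⟨ IsDerivation.δ-cong θ-isDerivation (T.*-identityʳ f) ⟩
    θ f                  T.≈⟨ T.*-identityˡ (θ f) ⟨
    T.1# T.* θ f         T.≈⟨ T.+-identityʳ (T.1# T.* θ f) ⟨
    T.1# T.* θ f T.+ T.0# T.∎
  θ-^ f (suc j) = T.begin
    θ (f T.* g)
      T.≈⟨ θ-leibniz f g ⟩
    θ f T.* g T.+ f T.* θ g
      T.≈⟨ T.+-cong (T.*-comm (θ f) g) (T.*-congˡ {f} (θ-^ f j)) ⟩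
    g T.* θ f T.+ f T.* (suc j T.· (f T.^ j T.* θ f))
      T.≈⟨ T.+-congˡ {g T.* θ f} (SemiringMult.×-comm-* T.semiring (suc j) f (f T.^ j T.* θ f)) ⟩
    g T.* θ f T.+ suc j T.· (f T.* (f T.^ j T.* θ f))
      T.≈⟨ T.+-congˡ {g T.* θ f} (SemiringMult.×-congʳ T.semiring (suc j) (T.sym (T.*-assoc f (f T.^ j) (θ f)))) ⟩
    g T.* θ f T.+ suc j T.· (g T.* θ f) T.∎
    where g = f T.^ suc j

  VanishesUpTo : ℕ → T.Carrier → Set ℓ
  VanishesUpTo k f = ∀ {m} → m ≤ k → f m ≈ 0#

  *-vanishes : ∀ {k f} g → VanishesUpTo k f → VanishesUpTo k (g T.* f)
  *-vanishes     g v {zero}  m≤k = trans (+-identityʳ _) (trans (*-congˡ (v m≤k)) (zeroʳ _))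
  *-vanishes {f = f} g v {suc m} m≤k = trans
    (+-cong (trans (*-congˡ (v m≤k)) (zeroʳ _)) (*-vanishes {f = f} (g ∘ suc) v (ℕ.≤-trans (ℕ.n≤1+n m) m≤k))) (+-identityˡ _)

  *-vanishes-suc : ∀ {k f} g → g 0 ≈ 0# → VanishesUpTo k f → VanishesUpTo (suc k) (g T.* f)
  *-vanishes-suc         g g₀ v {zero}  _         = trans (+-identityʳ _) (trans (*-congʳ g₀) (zeroˡ _))
  *-vanishes-suc {f = f} g g₀ v {suc m} (s≤s m≤k) = trans
    (+-cong (trans (*-congʳ g₀) (zeroˡ _)) (*-vanishes {f = f} (g ∘ suc) v m≤k)) (+-identityˡ _)

  -- Both u and f start in degree at least 1, so uᵏ f starts in degree at least k + 1. This removes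
  -- the boundary term when the logarithm is cut off at j = k.
  ^-*-vanishes : ∀ u f → u 0 ≈ 0# → f 0 ≈ 0# → ∀ k → VanishesUpTo k (u T.^ k T.* f)
  ^-*-vanishes u f u₀ f₀ zero    z≤n = trans (T.*-identityˡ f 0) f₀
  ^-*-vanishes u f u₀ f₀ (suc k) {m} m≤k = trans (T.*-assoc u (u T.^ k) f m)
    (*-vanishes-suc {f = u T.^ k T.* f} u u₀ (^-*-vanishes u f u₀ f₀ k) m≤k)

  telescope : ∀ k (w : ℕ → Carrier) → sum {k} (λ i → w (toℕ i) - w (suc (toℕ i))) ≈ w 0 - w k
  telescope zero    w = sym (-‿inverseʳ _)
  telescope (suc k) w = begin
    (w 0 - w 1) + sum {k} (λ i → w (suc (toℕ i)) - w (suc (suc (toℕ i)))) ≈⟨ +-congˡ (telescope k (w ∘ suc)) ⟩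
    (w 0 - w 1) + (w 1 - w (suc k))   ≈⟨ +-assoc _ _ _ ⟩
    w 0 + (- w 1 + (w 1 - w (suc k))) ≈⟨ +-congˡ (+-assoc _ _ _) ⟨
    w 0 + ((- w 1 + w 1) - w (suc k)) ≈⟨ +-congˡ (trans (+-congʳ (-‿inverseˡ _)) (+-identityˡ _)) ⟩
    w 0 - w (suc k)                   ∎

  module _ (ρ : ℚ → Carrier)
           (ρ-inverse : ∀ j a → ρ ((-1ℤ ℤ.^ suc (suc j)) / suc j) * (suc j · a) ≈ (- 1#) ^ j * a) where

    -- H (1 + u) Σ_{j<k} (-u)ʲ = H (1 - (-u)ᵏ), and the last term has no coefficient of degree ≤ k.
    logarithmic-derivative : ∀ F H → F 0 ≈ 1# → H 0 ≈ 0# → θ F T.≈ H T.* F →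
                             ∀ k → k · log rawRing ρ F k ≈ H k
    logarithmic-derivative F H F₀ H₀ θF k = begin
      k · sum {k} (λ i → term (toℕ i))
        ≈⟨ ·-sum {k} k (λ i → term (toℕ i)) ⟩
      sum {k} (λ i → k · term (toℕ i))
        ≈⟨ sum-cong-≋ {k} (λ i → step (toℕ i)) ⟩
      sum {k} (λ i → w (toℕ i) - w (suc (toℕ i)))
        ≈⟨ telescope k w ⟩
      w 0 - w k
        ≈⟨ +-cong (trans (*-identityˡ _) (T.*-identityˡ H k))
                  (trans (-‿cong (trans (*-congˡ (^-*-vanishes u H u₀ H₀ k ℕ.≤-refl)) (zeroʳ _))) -0#≈0#) ⟩
      H k + 0#
        ≈⟨ +-identityʳ _ ⟩
      H k ∎
      where
      u : T.Carrier
      u = F T.+ T.- T.1#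
      u₀ : u 0 ≈ 0#
      u₀ = trans (+-congʳ F₀) (-‿inverseʳ _)
      term w : ℕ → Carrier
      term j = ρ ((-1ℤ ℤ.^ suc (suc j)) / suc j) * (u T.^ suc j) k
      w j = (- 1#) ^ j * (u T.^ j T.* H) k
      -- With F = 1 + u the equation θF = H F reads θu = H + H u, so uʲ θu splits into two
      -- neighbouring terms of the telescope.
      θu : θ u T.≈ H T.+ H T.* u
      θu = T.begin
        θ u
          T.≈⟨ IsDerivation.δ-+ θ-isDerivation F (T.- T.1#) ⟩
        θ F T.+ θ (T.- T.1#)
          T.≈⟨ T.+-cong θF (T.trans (δ-neg T.1#) (T.trans (T.-‿cong δ-1) (λ _ → -0#≈0#))) ⟩
        H T.* F T.+ T.0#
          T.≈⟨ T.+-identityʳ (H T.* F) ⟩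
        H T.* F
          T.≈⟨ T.*-congˡ {H} (λ m → trans (+-comm _ _) (trans (+-assoc _ _ _) (trans (+-congˡ (-‿inverseˡ _)) (+-identityʳ _)))) ⟨
        H T.* (T.1# T.+ u)
          T.≈⟨ T.distribˡ H T.1# u ⟩
        H T.* T.1# T.+ H T.* u
          T.≈⟨ T.+-congʳ {H T.* u} (T.*-identityʳ H) ⟩
        H T.+ H T.* u T.∎
      power-step : ∀ j → u T.^ j T.* θ u T.≈ u T.^ j T.* H T.+ u T.^ suc j T.* H
      power-step j = T.begin
        u T.^ j T.* θ u                       T.≈⟨ T.*-congˡ {u T.^ j} θu ⟩
        u T.^ j T.* (H T.+ H T.* u)           T.≈⟨ T.distribˡ (u T.^ j) H (H T.* u) ⟩
        u T.^ j T.* H T.+ u T.^ j T.* (H T.* u) T.≈⟨ T.+-congˡ {u T.^ j T.* H} (rearrange (u T.^ j) H u) ⟩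
        u T.^ j T.* H T.+ u T.^ suc j T.* H   T.∎
        where
        rearrange : ∀ x y z → x T.* (y T.* z) T.≈ z T.* x T.* y
        rearrange x y z = T.trans (T.sym (T.*-assoc x y z)) (T.trans (T.*-comm (x T.* y) z) (T.sym (T.*-assoc z x y)))
      step : ∀ j → k · term j ≈ w j - w (suc j)
      step j = begin
        k · (ρ q * (u T.^ suc j) k)
          ≈⟨ ×-comm-* k (ρ q) _ ⟨
        ρ q * θ (u T.^ suc j) k
          ≈⟨ *-congˡ (trans (θ-^ u j k) (series-· (suc j) (u T.^ j T.* θ u) k)) ⟩
        ρ q * (suc j · (u T.^ j T.* θ u) k)
          ≈⟨ ρ-inverse j _ ⟩
        (- 1#) ^ j * (u T.^ j T.* θ u) k
          ≈⟨ *-congˡ (power-step j k) ⟩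
        (- 1#) ^ j * ((u T.^ j T.* H) k + (u T.^ suc j T.* H) k)
          ≈⟨ distribˡ _ _ _ ⟩
        w j + (- 1#) ^ j * (u T.^ suc j T.* H) k
          ≈⟨ +-congˡ (begin
               - (- 1# * (- 1#) ^ j * (u T.^ suc j T.* H) k) ≈⟨ -‿cong (trans (*-congʳ (-1*x≈-x _)) (sym (-‿distribˡ-* _ _))) ⟩
               - - ((- 1#) ^ j * (u T.^ suc j T.* H) k)      ≈⟨ ⁻¹-involutive _ ⟩
               (- 1#) ^ j * (u T.^ suc j T.* H) k            ∎) ⟨
        w j - w (suc j) ∎
        where q = (-1ℤ ℤ.^ suc (suc j)) / suc j

  series-sum : ∀ {n} (f : Fin n → T.Carrier) k → T.sum f k ≈ sum (λ i → f i k)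
  series-sum {zero}  f k = refl
  series-sum {suc n} f k = +-congˡ (series-sum (f ∘ suc) k)

  constantTerm-isHom : IsHom T.rawRing rawRing (λ f → f 0)
  constantTerm-isHom = record
    { cong    = λ p → p 0
    ; +-homo  = λ _ _ → refl
    ; *-homo  = λ _ _ → +-identityʳ _
    ; -‿homo  = λ _ → refl
    ; 0#-homo = refl
    ; 1#-homo = refl
    }

  constₜ-* : ∀ a f k → (constₜ rawRing a T.* f) k ≈ a * f k
  constₜ-* a f zero    = +-identityʳ _
  constₜ-* a f (suc k) = trans (+-congˡ (trans (T.*-congʳ {f} {constₜ rawRing a ∘ suc} {T.0#} (λ _ → refl) k)
    (T.zeroˡ f k))) (+-identityʳ _)

  t-*-suc : ∀ f k → (t rawRing T.* f) (suc k) ≈ f k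
  t-*-suc f k = trans (+-cong (zeroˡ _) (T.*-congʳ {f} {t rawRing ∘ suc} {T.1#} (λ { zero → refl ; (suc _) → refl }) k))
    (trans (+-identityˡ _) (T.*-identityˡ f k))

  t-*-zero : ∀ f → (t rawRing T.* f) 0 ≈ 0#
  t-*-zero f = trans (+-identityʳ _) (zeroˡ _)

  -- Matrix powers, their generating series and closed walks

  module _ {n} (Q : Matrix rawRing n) where

    I-tQ : Matrix T.rawRing n
    I-tQ i j = identity T.rawRing i j T.+ T.- (t rawRing T.* constₜ rawRing (Q i j))

    -- The index is shifted: `power⁺ k` is the power with exponent k + 1.
    power⁺ : ℕ → Matrix rawRing n
    power⁺ zero    = Q
    power⁺ (suc k) = _⊗_ rawRing Q (power⁺ k)

    -- Powers are built by multiplying on the left, whereas the recurrence for P multiplies by N on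
    -- the right. The two agree by associativity, in the form of an exchange of sums.
    power⁺-sucʳ : ∀ k i j → power⁺ (suc k) i j ≈ sum (λ l → Q l j * power⁺ k i l)
    power⁺-sucʳ zero    i j = sum-cong-≋ (λ l → *-comm (Q i l) (Q l j))
    power⁺-sucʳ (suc k) i j = begin
      sum (λ l → Q i l * power⁺ (suc k) l j)
        ≈⟨ sum-cong-≋ (λ l → trans (*-congˡ (power⁺-sucʳ k l j)) (*-distribˡ-sum (Q i l) (λ m → Q m j * power⁺ k l m))) ⟩
      sum (λ l → sum (λ m → Q i l * (Q m j * power⁺ k l m)))
        ≈⟨ ∑-comm (λ l m → Q i l * (Q m j * power⁺ k l m)) ⟩
      sum (λ m → sum (λ l → Q i l * (Q m j * power⁺ k l m)))
        ≈⟨ sum-cong-≋ (λ m → trans (sum-cong-≋ (λ l → x∙yz≈y∙xz (Q i l) (Q m j) (power⁺ k l m)))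
             (sym (*-distribˡ-sum (Q m j) (λ l → Q i l * power⁺ k l m)))) ⟩
      sum (λ m → Q m j * power⁺ (suc k) i m) ∎
      where
      open SemiringSum semiring using (∑-comm)
      open CommutativeSemigroupProperties *-commutativeSemigroup using (x∙yz≈y∙xz)

    -- Σ_{k≥1} Qᵏ tᵏ
    powers : Matrix T.rawRing n
    powers i j zero    = 0#
    powers i j (suc k) = power⁺ k i j

    -- This is P N + N = P for N = tQ. Multiplication by t lowers the degree to be compared by one,
    -- and in degree 1 only the summand N contributes.
    powers-recurrence : ∀ i j → T.sum (λ l → powers i l T.* (t rawRing T.* constₜ rawRing (Q l j)))
                                  T.+ t rawRing T.* constₜ rawRing (Q i j) T.≈ powers i j
    powers-recurrence i j k = begin
      T.sum (λ l → powers i l T.* tq l j) k + tq i j k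
        ≈⟨ +-congʳ (series-sum (λ l → powers i l T.* tq l j) k) ⟩
      sum (λ l → (powers i l T.* tq l j) k) + tq i j k
        ≈⟨ +-congʳ (sum-cong-≋ (λ l → shuffle l k)) ⟩
      sum (λ l → (t rawRing T.* (constₜ rawRing (Q l j) T.* powers i l)) k) + tq i j k
        ≈⟨ final k ⟩
      powers i j k ∎
      where
      tq : Matrix T.rawRing n
      tq l j = t rawRing T.* constₜ rawRing (Q l j)
      shuffle : ∀ l → powers i l T.* tq l j T.≈ t rawRing T.* (constₜ rawRing (Q l j) T.* powers i l)
      shuffle l = T.trans (T.*-comm (powers i l) (tq l j)) (T.*-assoc (t rawRing) (constₜ rawRing (Q l j)) (powers i l))
      inner : Fin n → T.Carrier
      inner l = constₜ rawRing (Q l j) T.* powers i l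
      tq-suc : ∀ k → tq i j (suc k) ≈ constₜ rawRing (Q i j) k
      tq-suc k = t-*-suc (constₜ rawRing (Q i j)) k
      final : ∀ k → sum (λ l → (t rawRing T.* inner l) k) + tq i j k ≈ powers i j k
      final zero = trans (+-cong
        (sum-zero A (λ l → (t rawRing T.* inner l) 0) (λ l → t-*-zero (inner l))) (t-*-zero (constₜ rawRing (Q i j)))) (+-identityˡ _)
      final (suc k) = trans (+-cong (sum-cong-≋ (λ l → trans (t-*-suc (inner l) k) (constₜ-* (Q l j) (powers i l) k))) (tq-suc k)) (last k)
        where
        last : ∀ k → sum (λ l → Q l j * powers i l k) + constₜ rawRing (Q i j) k ≈ power⁺ k i j
        last zero    = trans (+-congʳ (sum-zero A (λ l → Q l j * 0#) (λ l → zeroʳ _))) (+-identityˡ _)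
        last (suc k) = trans (+-identityʳ _) (sym (power⁺-sucʳ k i j))

    det-I-tQ-constant : det T.rawRing I-tQ 0 ≈ 1#
    det-I-tQ-constant = begin
      det T.rawRing I-tQ 0                    ≈⟨ det-homo T.rawRing A constantTerm-isHom I-tQ ⟩
      det rawRing (λ i j → I-tQ i j 0)        ≈⟨ det-cong A {n} entry ⟩
      det rawRing (identity rawRing {n})      ≈⟨ det-identity A n ⟩
      1#                                      ∎
      where
      entry : ∀ i j → I-tQ i j 0 ≈ identity rawRing i j
      entry i j = trans (+-congˡ (trans (-‿cong (t-*-zero (constₜ rawRing (Q i j)))) -0#≈0#)) (trans (+-identityʳ _) (diagonal i j))
        where
        diagonal : ∀ i j → identity T.rawRing i j 0 ≈ identity rawRing i j
        diagonal i j with i Fin.≟ j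
        ... | yes _ = refl
        ... | no _  = refl

    trace : ℕ → Carrier
    trace k = sum (λ i → powers i i k)

    θ-det-I-tQ : θ (det T.rawRing I-tQ) T.≈ (λ k → - trace k) T.* det T.rawRing I-tQ
    θ-det-I-tQ = T.trans (jacobi I-tQ (λ i j → T.- powers i j) entry)
      (T.*-congʳ {det T.rawRing I-tQ} (λ k → trans (series-sum (λ i → T.- powers i i) k) (sum-neg (λ i → powers i i k))))
      where
      sum-neg : ∀ {n} (f : Fin n → Carrier) → sum (λ i → - f i) ≈ - sum f
      sum-neg {zero}  f = sym -0#≈0#
      sum-neg {suc n} f = trans (+-congˡ (sum-neg (f ∘ suc))) (⁻¹-∙-comm _ _)
      tq : Matrix T.rawRing n
      tq i j = t rawRing T.* constₜ rawRing (Q i j)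
      module TR = RingProperties T.ring
      module TA = AbelianGroupProperties T.+-abelianGroup
      module TS = SemiringSum T.semiring
      θ-identity : ∀ i j → θ (identity T.rawRing i j) T.≈ T.0#
      θ-identity i j with i Fin.≟ j
      ... | yes _ = δ-1
      ... | no _  = IsDerivation.δ-0 θ-isDerivation
      -- The series tQ is concentrated in degree 1, where θ acts as the identity.
      θ-tq : ∀ i j → θ (tq i j) T.≈ tq i j
      θ-tq i j zero          = sym (t-*-zero (constₜ rawRing (Q i j)))
      θ-tq i j (suc zero)    = +-identityʳ _
      θ-tq i j (suc (suc k)) = trans (×-congʳ (suc (suc k)) z) (trans (·-0 (suc (suc k))) (sym z))
        where z = t-*-suc (constₜ rawRing (Q i j)) (suc k)
      entry : ∀ i j → θ (I-tQ i j) T.≈ T.sum (λ l → T.- powers i l T.* I-tQ l j)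
      entry i j = T.begin
        θ (I-tQ i j)
          T.≈⟨ IsDerivation.δ-+ θ-isDerivation (identity T.rawRing i j) (T.- tq i j) ⟩
        θ (identity T.rawRing i j) T.+ θ (T.- tq i j)
          T.≈⟨ T.+-cong (θ-identity i j) (T.trans (δ-neg (tq i j)) (T.-‿cong (θ-tq i j))) ⟩
        T.0# T.+ T.- tq i j
          T.≈⟨ T.+-identityˡ (T.- tq i j) ⟩
        T.- tq i j
          T.≈⟨ TA.inverseˡ-unique (T.sum (λ l → powers i l T.* tq l j) T.+ T.- powers i j) (tq i j) cancel ⟨
        T.sum (λ l → powers i l T.* tq l j) T.+ T.- powers i j
          T.≈⟨ T.+-comm (T.sum (λ l → powers i l T.* tq l j)) (T.- powers i j) ⟩
        T.- powers i j T.+ T.sum (λ l → powers i l T.* tq l j)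
          T.≈⟨ T.+-cong (T.sym on-diagonal) (TS.sum-cong-≋ (λ l → negate (powers i l) (tq l j))) ⟩
        T.sum (λ l → T.- powers i l T.* identity T.rawRing l j) T.+ T.sum (λ l → T.- powers i l T.* T.- tq l j)
          T.≈⟨ TS.∑-distrib-+ (λ l → T.- powers i l T.* identity T.rawRing l j) (λ l → T.- powers i l T.* T.- tq l j) ⟨
        T.sum (λ l → T.- powers i l T.* identity T.rawRing l j T.+ T.- powers i l T.* T.- tq l j)
          T.≈⟨ TS.sum-cong-≋ (λ l → T.distribˡ (T.- powers i l) (identity T.rawRing l j) (T.- tq l j)) ⟨
        T.sum (λ l → T.- powers i l T.* I-tQ l j) T.∎
        where
        cancel : (T.sum (λ l → powers i l T.* tq l j) T.+ T.- powers i j) T.+ tq i j T.≈ T.0#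
        cancel k = trans (trans (+-assoc _ _ _) (trans (+-congˡ (+-comm _ _)) (sym (+-assoc _ _ _))))
          (trans (+-congʳ (powers-recurrence i j k)) (-‿inverseʳ _))
        negate : ∀ x y → x T.* y T.≈ T.- x T.* T.- y
        negate x y = T.sym (T.trans (T.sym (TR.-‿distribˡ-* x (T.- y)))
          (T.trans (T.-‿cong (T.sym (TR.-‿distribʳ-* x y))) (TA.⁻¹-involutive (x T.* y))))
        on-diagonal : T.sum (λ l → T.- powers i l T.* identity T.rawRing l j) T.≈ T.- powers i j
        on-diagonal = T.trans (sum-single (seriesRing A) j (λ l → T.- powers i l T.* identity T.rawRing l j) off)
          (T.trans (T.*-congˡ {T.- powers i j} diagonal) (T.*-identityʳ (T.- powers i j)))
          where
          diagonal : identity T.rawRing j j T.≈ T.1#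
          diagonal = T.reflexive (≡.cong (if_then T.1# else T.0#) (dec-true (j Fin.≟ j) ≡.refl))
          off : ∀ l → l ≢ j → T.- powers i l T.* identity T.rawRing l j T.≈ T.0#
          off l l≢j = T.trans
            (T.*-congˡ {T.- powers i l} (T.reflexive (≡.cong (if_then T.1# else T.0#) (dec-false (l Fin.≟ j) l≢j))))
            (T.zeroʳ (T.- powers i l))

    module _ (ρ : ℚ → Carrier)
             (ρ-inverse : ∀ j a → ρ ((-1ℤ ℤ.^ suc (suc j)) / suc j) * (suc j · a) ≈ (- 1#) ^ j * a) where

      neg-log-det : ∀ k → k · (- log rawRing ρ (det T.rawRing I-tQ) k) ≈ trace k
      neg-log-det k = begin
        k · (- L)      ≈⟨ ·-neg k L ⟩
        - (k · L)      ≈⟨ -‿cong (logarithmic-derivative ρ ρ-inverse (det T.rawRing I-tQ) (λ k → - trace k) det-I-tQ-constant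
                            (trans (-‿cong (sum-zero A (λ i → powers i i 0) (λ i → refl))) -0#≈0#) θ-det-I-tQ k) ⟩
        - - trace k    ≈⟨ ⁻¹-involutive _ ⟩
        trace k        ∎
        where L = log rawRing ρ (det T.rawRing I-tQ) k

    walkProduct : ∀ {k} → Vec (Fin n × Fin n) k → Carrier
    walkProduct = Vec.foldr′ _*_ 1# ∘ Vec.map (uncurry Q)

    -- An entry (i, j) of the power with exponent k + 1 sums over the k interior vertices vs, with
    -- steps `zip (i ∷ vs) (vs ∷ʳ j)`. For j = i this is by definition `steps (i ∷ vs)`.
    trace-closed-walks : ∀ k → trace (suc k) ≈ listSum rawRing (vecsOver (allFin n) (suc k)) (walkProduct ∘ steps)
    trace-closed-walks k = begin
      sum (λ i → power⁺ k i i)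
        ≈⟨ sum-cong-≋ (λ i → walks k i i) ⟩
      sum (λ i → Σ (vecsOver (allFin n) k) (λ vs → walkProduct (steps (i ∷ vs))))
        ≈⟨ listSum-allFin A n _ ⟨
      Σ (allFin n) (λ i → Σ (vecsOver (allFin n) k) (λ vs → walkProduct (steps (i ∷ vs))))
        ≈⟨ listSum-cartesianProductWith A _∷_ (allFin n) (vecsOver (allFin n) k) (walkProduct ∘ steps) ⟨
      Σ (vecsOver (allFin n) (suc k)) (walkProduct ∘ steps) ∎
      where
      Σ : {B : Set} → List B → (B → Carrier) → Carrier
      Σ = listSum rawRing
      walks : ∀ k i j → power⁺ k i j ≈ Σ (vecsOver (allFin n) k) (λ vs → walkProduct (Vec.zip (i ∷ vs) (vs ∷ʳ j)))
      walks zero    i j = sym (trans (+-identityʳ _) (*-identityʳ _))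
      walks (suc k) i j = begin
        sum (λ l → Q i l * power⁺ k l j)
          ≈⟨ sum-cong-≋ (λ l → trans (*-congˡ (walks k l j)) (*-distribˡ-listSum A (Q i l) (vecsOver (allFin n) k) _)) ⟩
        sum (λ l → Σ (vecsOver (allFin n) k) (λ vs → w (l ∷ vs)))
          ≈⟨ listSum-allFin A n _ ⟨
        Σ (allFin n) (λ l → Σ (vecsOver (allFin n) k) (λ vs → w (l ∷ vs)))
          ≈⟨ listSum-cartesianProductWith A _∷_ (allFin n) (vecsOver (allFin n) k) w ⟨
        Σ (vecsOver (allFin n) (suc k)) w ∎
        where
        w : Vec (Fin n) (suc k) → Carrier
        w vs = walkProduct (Vec.zip (i ∷ vs) (vs ∷ʳ j))

-- Cyclic sequences

module _ {f : A → A} where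

  iterate-induction : ∀ {P : A → Set p} → (∀ x → P x → P (f x)) →
                      ∀ m {x y} → P x → y ∈ iterate f x m → P y
  iterate-induction step (suc m) px (here ≡.refl) = px
  iterate-induction step (suc m) px (there y∈)  = iterate-induction step m (step _ px) y∈

spin : ℕ → Vec A k → Vec A k
spin zero    c = c
spin (suc m) c = spin m (rotate c)

spin-rotate : ∀ m (c : Vec A k) → spin m (rotate c) ≡ rotate (spin m c)
spin-rotate zero    c = ≡.refl
spin-rotate (suc m) c = spin-rotate m (rotate c)

rotateList : List A → List A
rotateList []       = []
rotateList (x ∷ xs) = xs ++ List.[ x ]

toList-rotate : (c : Vec A k) → toList (rotate c) ≡ rotateList (toList c)
toList-rotate []       = ≡.refl
toList-rotate (v ∷ vs) = Vec.toList-∷ʳ v vs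

-- Each rotation moves one entry of the first block behind the second. Lists are used because the
-- vectors xs ++ ys and ys ++ xs have different types.
toList-spin : (xs ys : List A) (c : Vec A k) → toList c ≡ xs ++ ys →
              toList (spin (List.length xs) c) ≡ ys ++ xs
toList-spin []       ys c eq = ≡.trans eq (≡.sym (List.++-identityʳ ys))
toList-spin (x ∷ xs) ys c eq = ≡.trans
  (toList-spin xs (ys ++ List.[ x ]) (rotate c)
    (≡.trans (toList-rotate c) (≡.trans (≡.cong rotateList eq) (List.++-assoc xs ys List.[ x ]))))
  (List.++-assoc ys List.[ x ] xs)

spin-period : (c : Vec A k) → spin k c ≡ c
spin-period {k = k} c = ≡.trans (≡.sym (Vec.cast-is-id ≡.refl _)) (Vec.toList-injective ≡.refl (spin k c) c
  (≡.trans (≡.cong (λ m → toList (spin m c)) (≡.sym (Vec.length-toList c)))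
         (toList-spin (toList c) [] c (≡.sym (List.++-identityʳ (toList c))))))

rotate-spin : (c : Vec A (suc k)) → rotate (spin k c) ≡ c
rotate-spin {k = k} c = ≡.trans (≡.sym (spin-rotate k c)) (spin-period c)

-- The dihedral relation: conjugation by `reverse` inverts `rotate`.
rotate-reverse-rotate : (c : Vec A k) → rotate (reverse (rotate c)) ≡ reverse c
rotate-reverse-rotate []       = ≡.refl
rotate-reverse-rotate (v ∷ vs) = begin
  rotate (reverse (vs ∷ʳ v))                     ≡⟨ ≡.cong (λ ws → rotate (reverse (ws ∷ʳ v))) (Vec.reverse-involutive vs) ⟨
  rotate (reverse (reverse (reverse vs) ∷ʳ v))   ≡⟨ ≡.cong (rotate ∘ reverse) (Vec.reverse-∷ v (reverse vs)) ⟨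
  rotate (reverse (reverse (v ∷ reverse vs)))    ≡⟨ ≡.cong rotate (Vec.reverse-involutive (v ∷ reverse vs)) ⟩
  reverse vs ∷ʳ v                                ≡⟨ Vec.reverse-∷ v vs ⟨
  reverse (v ∷ vs)                               ∎
  where open ≡-Reasoning

reverse-rotate : (c : Vec A (suc k)) → reverse (rotate c) ≡ spin k (reverse c)
reverse-rotate {k = k} c = ≡.trans (≡.sym (spin-period (reverse (rotate c)))) (≡.cong (spin k) (rotate-reverse-rotate c))

module _ {P : ∀ {k} → Vec A k → Set p} (P-rotate : ∀ {k} (c : Vec A k) → P c → P (rotate c)) where

  spin-closed : ∀ m (c : Vec A k) → P c → P (spin m c)
  spin-closed zero    c pc = pc
  spin-closed (suc m) c pc = spin-closed m (rotate c) (P-rotate c pc)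

  -- The hypothesis is applied to the last rotation of c, which one more `rotate` turns back into c.
  -- It concerns `reverse ∘ rotate` because the steps of that composite have a closed form, given by
  -- `steps-reverse-rotate`.
  reverse-closed : (∀ {k} (c : Vec A k) → P c → P (reverse (rotate c))) → (c : Vec A (suc k)) → P c → P (reverse c)
  reverse-closed {k = k} P-reverse-rotate c pc = ≡.subst P (≡.cong reverse (rotate-spin c))
    (P-reverse-rotate (spin k c) (spin-closed k c pc))

∈-iterate-suc : ∀ m {c y : Vec A k} → y ∈ iterate rotate c (suc m) → y ∈ iterate rotate c m ⊎ y ≡ spin m c
∈-iterate-suc zero    (here y≡)  = inj₂ y≡
∈-iterate-suc (suc m) (here y≡)  = inj₁ (here y≡)
∈-iterate-suc (suc m) (there y∈) = [ inj₁ ∘ there , inj₂ ]′ (∈-iterate-suc m y∈)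

rotate-∈-iterate : ∀ m {c y : Vec A k} → y ∈ iterate rotate c m → rotate y ∈ iterate rotate (rotate c) m
rotate-∈-iterate (suc m) (here y≡)  = here (≡.cong rotate y≡)
rotate-∈-iterate (suc m) (there y∈) = there (rotate-∈-iterate m y∈)

rotations : Vec A k → List (Vec A k)
rotations {k = k} c = iterate rotate c k

-- One further rotation turns the iterates 0, ..., k into 1, ..., k + 1, and the last of these is c
-- again.
rotations-rotate : {c y : Vec A (suc k)} → y ∈ rotations c → rotate y ∈ rotations c
rotations-rotate {k = k} {c} y∈ with ∈-iterate-suc (suc k) {c} (there (rotate-∈-iterate (suc k) y∈))
... | inj₁ ry∈ = ry∈
... | inj₂ ry≡ = here (≡.trans ry≡ (spin-period c))

rotations-spin : ∀ m {c y : Vec A (suc k)} → y ∈ rotations c → spin m y ∈ rotations c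
rotations-spin zero    y∈ = y∈
rotations-spin (suc m) y∈ = rotations-spin m (rotations-rotate y∈)

rotations-reverse : {c y : Vec A (suc k)} → y ∈ rotations c → reverse y ∈ rotations (reverse c)
rotations-reverse {k = k} {c} = iterate-induction
  (λ x rx∈ → ≡.subst (_∈ rotations (reverse c)) (≡.sym (reverse-rotate x)) (rotations-spin k rx∈)) (suc k) (here ≡.refl)

sameCycle-refl : (c : Vec A (suc k)) → SameCycle c c
sameCycle-refl c = here ≡.refl

module _ {P : Vec A k → Set p} (P-rotate : ∀ c → P c → P (rotate c)) (P-reverse : ∀ c → P c → P (reverse c)) where

  -- This induction principle yields transitivity and symmetry of `SameCycle`, and later the
  -- invariance of cycle weights.
  orbit-closed : ∀ {c d} → P c → SameCycle c d → P d
  orbit-closed {c} pc d∈ = [ iterate-induction P-rotate k pc , iterate-induction P-rotate k (P-reverse c pc) ]′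
    (∈.∈-++⁻ (rotations c) d∈)

sameCycle-rotate : (c d : Vec A (suc k)) → SameCycle c d → SameCycle c (rotate d)
sameCycle-rotate c d d∈ = [ ∈.∈-++⁺ˡ ∘ rotations-rotate , ∈.∈-++⁺ʳ (rotations c) ∘ rotations-rotate ]′
  (∈.∈-++⁻ (rotations c) d∈)

sameCycle-reverse : (c d : Vec A (suc k)) → SameCycle c d → SameCycle c (reverse d)
sameCycle-reverse c d d∈ =
  [ ∈.∈-++⁺ʳ (rotations c) ∘ rotations-reverse
  , ∈.∈-++⁺ˡ ∘ ≡.subst (λ e → reverse d ∈ rotations e) (Vec.reverse-involutive c) ∘ rotations-reverse ]′
  (∈.∈-++⁻ (rotations c) d∈)

sameCycle-trans : {c d e : Vec A (suc k)} → SameCycle c d → SameCycle d e → SameCycle c e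
sameCycle-trans {c = c} = orbit-closed (sameCycle-rotate c) (sameCycle-reverse c)

sameCycle-sym : {c d : Vec A (suc k)} → SameCycle c d → SameCycle d c
sameCycle-sym {k = k} {c = c} = orbit-closed {P = λ d → SameCycle d c}
  -- Rotating `rotate d` another k times completes the period and returns d.
  (λ d c∈ → sameCycle-trans (∈.∈-++⁺ˡ (≡.subst (_∈ rotations (rotate d)) (spin-period d) (rotations-spin k {rotate d} (here ≡.refl)))) c∈)
  (λ d c∈ → sameCycle-trans (≡.subst (SameCycle (reverse d)) (Vec.reverse-involutive d)
                              (sameCycle-reverse (reverse d) (reverse d) (sameCycle-refl (reverse d)))) c∈)
  (sameCycle-refl c)

orbits-disjoint : {c d : Vec A (suc k)} → ¬ SameCycle c d → Disjoint (dihedralOrbit c) (dihedralOrbit d)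
orbits-disjoint ¬same (v∈c , v∈d) = ¬same (sameCycle-trans v∈c (sameCycle-sym v∈d))

module _ {P : A → Set p} where

  All-∷ʳ⁺ : ∀ {x} {xs : Vec A k} → All P xs → P x → All P (xs ∷ʳ x)
  All-∷ʳ⁺ []         px = px ∷ []
  All-∷ʳ⁺ (py ∷ pxs) px = py ∷ All-∷ʳ⁺ pxs px

  All-∷ʳ⁻ : ∀ {x} (xs : Vec A k) → All P (xs ∷ʳ x) → P x × All P xs
  All-∷ʳ⁻ []       (px ∷ [])  = px , []
  All-∷ʳ⁻ (y ∷ xs) (py ∷ pxs) = let px , pxs′ = All-∷ʳ⁻ xs pxs in px , py ∷ pxs′

  All-rotate⁺ : {xs : Vec A k} → All P xs → All P (rotate xs)
  All-rotate⁺ []         = []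
  All-rotate⁺ (px ∷ pxs) = All-∷ʳ⁺ pxs px

  All-rotate⁻ : (xs : Vec A k) → All P (rotate xs) → All P xs
  All-rotate⁻ []       []  = []
  All-rotate⁻ (x ∷ xs) pxs = let px , pxs′ = All-∷ʳ⁻ xs pxs in px ∷ pxs′

  All-reverse⁺ : {xs : Vec A k} → All P xs → All P (reverse xs)
  All-reverse⁺ []                       = []
  All-reverse⁺ {xs = x ∷ xs} (px ∷ pxs) = ≡.subst (All P) (≡.sym (Vec.reverse-∷ x xs)) (All-∷ʳ⁺ (All-reverse⁺ pxs) px)

Unique-∷ʳ⁺ : ∀ {x} {xs : Vec A k} → Unique xs → All (x ≢_) xs → Unique (xs ∷ʳ x)
Unique-∷ʳ⁺ []         []          = [] ∷ []
Unique-∷ʳ⁺ (y∉ ∷ xs!) (x≢y ∷ x∉) = All-∷ʳ⁺ y∉ (x≢y ∘ ≡.sym) ∷ Unique-∷ʳ⁺ xs! x∉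

Unique-rotate : {xs : Vec A k} → Unique xs → Unique (rotate xs)
Unique-rotate []         = []
Unique-rotate (x∉ ∷ xs!) = Unique-∷ʳ⁺ xs! x∉

Unique-reverse : {xs : Vec A k} → Unique xs → Unique (reverse xs)
Unique-reverse []                       = []
Unique-reverse {xs = x ∷ xs} (x∉ ∷ xs!) =
  ≡.subst Unique (≡.sym (Vec.reverse-∷ x xs)) (Unique-∷ʳ⁺ (Unique-reverse xs!) (All-reverse⁺ x∉))

Unique-toList : {xs : Vec A k} → Unique xs → List.Unique (toList xs)
Unique-toList []         = ListAllPairs.[]
Unique-toList (x∉ ∷ xs!) = All.toList⁺ x∉ ListAllPairs.∷ Unique-toList xs!

zip-∷ʳ : ∀ (xs : Vec A k) (ys : Vec B k) x y → zip (xs ∷ʳ x) (ys ∷ʳ y) ≡ zip xs ys ∷ʳ (x , y)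
zip-∷ʳ []        []        x y = ≡.refl
zip-∷ʳ (x′ ∷ xs) (y′ ∷ ys) x y = ≡.cong ((x′ , y′) ∷_) (zip-∷ʳ xs ys x y)

zip-rotate : ∀ (xs : Vec A k) (ys : Vec B k) → zip (rotate xs) (rotate ys) ≡ rotate (zip xs ys)
zip-rotate []       []       = ≡.refl
zip-rotate (x ∷ xs) (y ∷ ys) = zip-∷ʳ xs ys x y

zip-reverse : ∀ (xs : Vec A k) (ys : Vec B k) → zip (reverse xs) (reverse ys) ≡ reverse (zip xs ys)
zip-reverse []       []       = ≡.refl
zip-reverse (x ∷ xs) (y ∷ ys) = begin
  zip (reverse (x ∷ xs)) (reverse (y ∷ ys))    ≡⟨ ≡.cong₂ zip (Vec.reverse-∷ x xs) (Vec.reverse-∷ y ys) ⟩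
  zip (reverse xs ∷ʳ x) (reverse ys ∷ʳ y)      ≡⟨ zip-∷ʳ (reverse xs) (reverse ys) x y ⟩
  zip (reverse xs) (reverse ys) ∷ʳ (x , y)     ≡⟨ ≡.cong (_∷ʳ (x , y)) (zip-reverse xs ys) ⟩
  reverse (zip xs ys) ∷ʳ (x , y)               ≡⟨ Vec.reverse-∷ (x , y) (zip xs ys) ⟨
  reverse ((x , y) ∷ zip xs ys)                ∎
  where open ≡-Reasoning

zip-swap : ∀ (xs : Vec A k) (ys : Vec B k) → zip ys xs ≡ Vec.map swap (zip xs ys)
zip-swap []       []       = ≡.refl
zip-swap (x ∷ xs) (y ∷ ys) = ≡.cong ((y , x) ∷_) (zip-swap xs ys)

steps-rotate : (c : Vec A k) → steps (rotate c) ≡ rotate (steps c)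
steps-rotate c = zip-rotate c (rotate c)

-- By the dihedral relation the successors of `reverse (rotate c)` form `reverse c`, so both
-- arguments of `zip` are reversals, with their roles exchanged. For `reverse c` alone the steps
-- would match only up to a rotation.
steps-reverse-rotate : (c : Vec A k) → steps (reverse (rotate c)) ≡ reverse (Vec.map swap (steps c))
steps-reverse-rotate c = begin
  zip (reverse (rotate c)) (rotate (reverse (rotate c)))  ≡⟨ ≡.cong (zip (reverse (rotate c))) (rotate-reverse-rotate c) ⟩
  zip (reverse (rotate c)) (reverse c)                    ≡⟨ zip-reverse (rotate c) c ⟩
  reverse (zip (rotate c) c)                              ≡⟨ ≡.cong reverse (zip-swap c (rotate c)) ⟩
  reverse (Vec.map swap (steps c))                        ∎
  where open ≡-Reasoning

All-zipˡ : ∀ {P : A → Set p} {xs : Vec A k} → All P xs → (ys : Vec B k) → All (P ∘ proj₁) (zip xs ys)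
All-zipˡ []         []       = []
All-zipˡ (px ∷ pxs) (y ∷ ys) = px ∷ All-zipˡ pxs ys

-- The rotations of a sequence start with its successive entries, so distinct entries tell the
-- rotations apart.
take₁-rotations : (xs ys : List A) (c : Vec A k) → toList c ≡ xs ++ ys →
                  List.map (List.take 1 ∘ toList) (iterate rotate c (List.length xs)) ≡ List.map List.[_] xs
take₁-rotations []       ys c eq = ≡.refl
take₁-rotations (x ∷ xs) ys c eq = ≡.cong₂ _∷_ (≡.cong (List.take 1) eq)
  (take₁-rotations xs (ys ++ List.[ x ]) (rotate c)
    (≡.trans (toList-rotate c) (≡.trans (≡.cong rotateList eq) (List.++-assoc xs ys List.[ x ]))))

Unique-rotations : {c : Vec A k} → Unique c → List.Unique (rotations c)
Unique-rotations {k = k} {c} c! = ListUnique.map⁻ (≡.subst List.Unique (≡.sym first-entries)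
  (ListUnique.map⁺ (λ { ≡.refl → ≡.refl }) (Unique-toList c!)))
  where
  first-entries : List.map (List.take 1 ∘ toList) (rotations c) ≡ List.map List.[_] (toList c)
  first-entries = ≡.trans (≡.cong (List.map (List.take 1 ∘ toList) ∘ iterate rotate c) (≡.sym (Vec.length-toList c)))
    (take₁-rotations (toList c) [] c (≡.sym (List.++-identityʳ (toList c))))

-- If c starts with v₁, v₂ then (v₁ , v₂) is a step of every rotation of c and of no rotation of its reverse.
rotations-reverse-disjoint : {c : Vec A (suc (suc (suc k)))} → Unique c →
                             ∀ {d} → d ∈ rotations c → ¬ d ∈ rotations (reverse c)
rotations-reverse-disjoint {A = A} {k} {c = c@(v₁ ∷ v₂ ∷ v₃ ∷ vs)} ((v₁≢v₂ ∷ v₁≢v₃ ∷ v₁∉) ∷ (v₂∉ ∷ _)) d∈ d∈′ =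
  iterate-induction {P = λ x → ¬ Avoids (v₁ , v₂) x}
    (λ x ¬a a → ¬a (All-rotate⁻ (steps x) (≡.subst (All _) (steps-rotate x) a))) _ (λ { (≢ ∷ _) → ≢ ≡.refl }) d∈
    (iterate-induction {P = Avoids (v₁ , v₂)} (λ x → avoids-rotate x) _ avoids-reverse d∈′)
  where
  Avoids : A × A → Vec A m → Set
  Avoids s x = All (_≢ s) (steps x)
  avoids-rotate : ∀ {s} (x : Vec A m) → Avoids s x → Avoids s (rotate x)
  avoids-rotate x a = ≡.subst (All _) (≡.sym (steps-rotate x)) (All-rotate⁺ a)
  -- Length at least 3 enters here: the only step leaving v₂ goes to v₃, which differs from v₁.
  avoids-c : Avoids (v₂ , v₁) c
  avoids-c = (λ { ≡.refl → v₁≢v₂ ≡.refl }) ∷ (λ { ≡.refl → v₁≢v₃ ≡.refl })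
    ∷ All.map (λ v₂≢ eq → v₂≢ (≡.sym (≡.cong proj₁ eq))) (All-zipˡ v₂∉ (vs ∷ʳ v₁))
  -- Since rotate e = c, the steps of `reverse c` are those of `reverse (rotate e)`, which are the
  -- swapped steps of e in reverse order.
  e : Vec A (suc (suc (suc k)))
  e = spin (suc (suc k)) c
  avoids-reverse : Avoids (v₁ , v₂) (reverse c)
  avoids-reverse = ≡.subst (Avoids (v₁ , v₂) ∘ reverse) (rotate-spin c) (≡.subst (All _) (≡.sym (steps-reverse-rotate e))
    (All-reverse⁺ (All.map⁺ (All.map (λ ≢ eq → ≢ (≡.cong swap eq))
      (spin-closed {P = Avoids (v₂ , v₁)} avoids-rotate (suc (suc k)) c avoids-c)))))

-- Rotations are distinct among themselves, and no rotation of c equals one of its reverse. At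
-- length 2 the second part would fail.
Unique-orbit : {c : Vec A (suc (suc (suc k)))} → Unique c → List.Unique (dihedralOrbit c)
Unique-orbit c! = ListUnique.++⁺ (Unique-rotations c!) (Unique-rotations (Unique-reverse c!))
  (uncurry (rotations-reverse-disjoint c!))

length-orbit : (c : Vec A k) → List.length (dihedralOrbit c) ≡ k ℕ.+ k
length-orbit {k = k} c = ≡.trans (List.length-++ (rotations c))
  (≡.cong₂ ℕ._+_ (List.length-iterate rotate c k) (List.length-iterate rotate (reverse c) k))

∈-vecsOver : {as : List A} → (∀ a → a ∈ as) → (v : Vec A k) → v ∈ vecsOver as k
∈-vecsOver ∈as []      = here ≡.refl
∈-vecsOver ∈as (a ∷ v) = ∈.∈-cartesianProductWith⁺ _∷_ (∈as a) (∈-vecsOver ∈as v)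

Unique-vecsOver : {as : List A} → List.Unique as → ∀ k → List.Unique (vecsOver as k)
Unique-vecsOver as! zero    = ListAll.[] ListAllPairs.∷ ListAllPairs.[]
Unique-vecsOver as! (suc k) = ListUnique.cartesianProductWith⁺ _∷_ Vec.∷-injective as! (Unique-vecsOver as! k)

deduplicate-pairs : {R : Rel A p} (R? : Binary.Decidable R) (xs : List A) →
                    ListAllPairs.AllPairs (λ x y → ¬ R x y) (deduplicate R? xs)
deduplicate-pairs R? []       = ListAllPairs.[]
deduplicate-pairs R? (x ∷ xs) =
  ListAll.all-filter (¬? ∘ R? x) (deduplicate R? xs) ListAllPairs.∷ ListAllPairs.filter⁺ _ (deduplicate-pairs R? xs)

-- Membership in a duplicate-free list has at most one proof, so mutual inclusion is already a
-- bijection of membership proofs.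
unique-↭ : {xs ys : List A} → List.Unique xs → List.Unique ys →
           (∀ {x} → x ∈ xs → x ∈ ys) → (∀ {x} → x ∈ ys → x ∈ xs) → xs ↭ ys
unique-↭ xs! ys! to from = ∼bag⇒↭ (mk↔ₛ′ to from
  (λ _ → ∈.unique⇒irrelevant ys! _ _) (λ _ → ∈.unique⇒irrelevant xs! _ _))

-- Cycles of a graph and their vertex sequences

module _ (G : SimpleGraph n) where
  open SimpleGraph G

  IsCycle-rotate : (c : Vec (Fin n) k) → IsCycle G c → IsCycle G (rotate c)
  IsCycle-rotate c (3≤k , c! , c~) = 3≤k , Unique-rotate c! , ≡.subst (All _) (≡.sym (steps-rotate c)) (All-rotate⁺ c~)

  IsCycle-reverse : (c : Vec (Fin n) (suc k)) → IsCycle G c → IsCycle G (reverse c)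
  IsCycle-reverse = reverse-closed {P = IsCycle G} IsCycle-rotate (λ c (3≤k , c! , c~) →
    3≤k , Unique-reverse (Unique-rotate c!) ,
    ≡.subst (All _) (≡.sym (steps-reverse-rotate c)) (All-reverse⁺ (All.map⁺ (All.map ~-sym c~))))

  cycleSequences : ∀ k → List (Vec (Fin n) k)
  cycleSequences k = filter (isCycle? G) (vecsOver (allFin n) k)

  all-cycles-IsCycle : ∀ k → ListAll.All (IsCycle G) (cycles G k)
  all-cycles-IsCycle k = ListAll.deduplicate⁺ sameCycle? (ListAll.all-filter (isCycle? G) (vecsOver (allFin n) k))

  -- The orbits of the representatives partition the cycle sequences. They are duplicate-free by
  -- length at least 3, disjoint because deduplication leaves inequivalent representatives, and
  -- exhaustive because it keeps one from each class.
  cycleSequences-↭ : ∀ k → cycleSequences (suc (suc (suc k))) ↭ concatMap dihedralOrbit (cycles G (suc (suc (suc k))))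
  cycleSequences-↭ k = unique-↭
    (ListUnique.filter⁺ (isCycle? G) (Unique-vecsOver (ListUnique.allFin⁺ n) (suc (suc (suc k)))))
    (ListUnique.concat⁺
      (ListAll.map⁺ (ListAll.map (λ (_ , c! , _) → Unique-orbit c!) (all-cycles-IsCycle (suc (suc (suc k))))))
      (ListAllPairs.map⁺ (ListAllPairs.map orbits-disjoint
        (deduplicate-pairs sameCycle? (cycleSequences (suc (suc (suc k))))))))
    (λ c∈ → ∈.∈-concatMap⁺ dihedralOrbit (ListAny.deduplicate⁺ sameCycle? sameCycle-trans
      (ListAny.map (λ { ≡.refl → sameCycle-refl _ }) c∈)))
    (λ {c} c∈ → let d , d∈ , c∈d = find (∈.∈-concatMap⁻ dihedralOrbit {xs = cycles G (suc (suc (suc k)))} c∈) in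
      ∈.∈-filter⁺ (isCycle? G) (∈-vecsOver ∈.∈-allFin c)
        (orbit-closed {P = IsCycle G} IsCycle-rotate IsCycle-reverse
          (ListAll.lookup (all-cycles-IsCycle (suc (suc (suc k)))) d∈) c∈d))

  cycles-empty : ∀ k → n ℕ.< k → cycles G k ≡ []
  cycles-empty k n<k = ≡.cong (deduplicate sameCycle?) (List.filter-none (isCycle? G)
    (ListAll.universal (λ c (_ , c! , _) → too-long c c!) (vecsOver (allFin n) k)))
    where
    too-long : (c : Vec (Fin n) k) → ¬ Unique c
    too-long c c! = let i , j , i<j , eq = Fin.pigeonhole n<k (Vec.lookup c) in
      Fin.<⇒≢ i<j (Unique.lookup-injective c! i j eq)

-- Closed walks in the squarefree algebra

module _ (K : CommutativeRing c ℓ) where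
  open CommutativeRing K hiding (zero)
  open SemiringMult semiring using (×-congʳ) renaming (_×_ to _·_)
  open CommutativeMonoidMult +-commutativeMonoid using (×-distrib-+)
  open CommutativeSemigroupProperties +-commutativeSemigroup using (x∙yz≈y∙xz)
  open SemiringSum semiring using (sum; sum-cong-≋; ∑-comm)
  open SetoidReasoning setoid
  private
    Σ : List A → (A → Carrier) → Carrier
    Σ = listSum rawRing

  listSum-cong-All : {xs : List A} {f g : A → Carrier} → ListAll.All (λ x → f x ≈ g x) xs → Σ xs f ≈ Σ xs g
  listSum-cong-All ListAll.[]         = refl
  listSum-cong-All (eq ListAll.∷ eqs) = +-cong eq (listSum-cong-All eqs)

  listSum-zero : (xs : List A) (f : A → Carrier) → (∀ x → f x ≈ 0#) → Σ xs f ≈ 0#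
  listSum-zero []       f eq = refl
  listSum-zero (x ∷ xs) f eq = trans (+-cong (eq x) (listSum-zero xs f eq)) (+-identityˡ _)

  listSum-· : ∀ k (xs : List A) (f : A → Carrier) → Σ xs (λ x → k · f x) ≈ k · Σ xs f
  listSum-· k []       f = sym (·-0 K k)
  listSum-· k (x ∷ xs) f = trans (+-congˡ (listSum-· k xs f)) (sym (×-distrib-+ _ _ k))

  listSum-const : {xs : List A} {f : A → Carrier} {a : Carrier} → ListAll.All (λ x → f x ≈ a) xs → Σ xs f ≈ List.length xs · a
  listSum-const ListAll.[]         = refl
  listSum-const (eq ListAll.∷ eqs) = +-cong eq (listSum-const eqs)

  listSum-filter : {P : Pred A p} (P? : Decidable P) (xs : List A) {f g : A → Carrier} →
                   (∀ x → P x → f x ≈ g x) → (∀ x → ¬ P x → f x ≈ 0#) → Σ xs f ≈ Σ (filter P? xs) g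
  listSum-filter P? []       on off = refl
  listSum-filter P? (x ∷ xs) on off with P? x
  ... | yes px = +-cong (on x px) (listSum-filter P? xs on off)
  ... | no ¬px = trans (+-cong (off x ¬px) (listSum-filter P? xs on off)) (+-identityˡ _)

  listSum-↭ : {xs ys : List A} (f : A → Carrier) → xs ↭ ys → Σ xs f ≈ Σ ys f
  listSum-↭ f ↭.refl          = refl
  listSum-↭ f (↭.prep x p)    = +-congˡ (listSum-↭ f p)
  listSum-↭ f (↭.swap x y p)  = trans (+-congˡ (+-congˡ (listSum-↭ f p))) (x∙yz≈y∙xz _ _ _)
  listSum-↭ f (↭.trans p q)   = trans (listSum-↭ f p) (listSum-↭ f q)

  listSum-concatMap : (g : A → List B) (xs : List A) (f : B → Carrier) → Σ (concatMap g xs) f ≈ Σ xs (λ x → Σ (g x) f)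
  listSum-concatMap g []       f = refl
  listSum-concatMap g (x ∷ xs) f = trans (listSum-++ K (g x) _ f) (+-congˡ (listSum-concatMap g xs f))

  listSum-pairs : (f : Fin n → Fin n → Carrier) →
                  Σ (cartesianProduct (allFin n) (allFin n)) (uncurry f) ≈ sum (λ i → sum (f i))
  listSum-pairs {n} f = begin
    Σ (cartesianProduct (allFin n) (allFin n)) (uncurry f) ≈⟨ listSum-cartesianProductWith K _,_ (allFin n) (allFin n) (uncurry f) ⟩
    Σ (allFin n) (λ i → Σ (allFin n) (f i))                ≈⟨ listSum-allFin K n (λ i → Σ (allFin n) (f i)) ⟩
    sum (λ i → Σ (allFin n) (f i))                         ≈⟨ sum-cong-≋ (λ i → listSum-allFin K n (f i)) ⟩
    sum (λ i → sum (f i))                                  ∎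

  module _ (M : Matrix rawRing n) where
    private
      W : Vec (Fin n × Fin n) k → Carrier
      W = walkProduct K M

    walkProduct-∷ʳ : ∀ (xs : Vec _ k) x → W (xs ∷ʳ x) ≈ uncurry M x * W xs
    walkProduct-∷ʳ []       x = refl
    walkProduct-∷ʳ (y ∷ xs) x = trans (*-congˡ (walkProduct-∷ʳ xs x)) (x∙yz≈y∙xz* _ _ _)
      where open CommutativeSemigroupProperties *-commutativeSemigroup using () renaming (x∙yz≈y∙xz to x∙yz≈y∙xz*)

    walkProduct-rotate : ∀ (xs : Vec _ k) → W (rotate xs) ≈ W xs
    walkProduct-rotate []       = refl
    walkProduct-rotate (x ∷ xs) = walkProduct-∷ʳ xs x

    walkProduct-reverse : ∀ (xs : Vec _ k) → W (reverse xs) ≈ W xs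
    walkProduct-reverse []       = refl
    walkProduct-reverse (x ∷ xs) = trans (reflexive (≡.cong W (Vec.reverse-∷ x xs)))
      (trans (walkProduct-∷ʳ (reverse xs) x) (*-congˡ (walkProduct-reverse xs)))

    walkProduct-zero : ∀ {E : Fin n × Fin n → Set} (E? : Decidable E) → (∀ x → ¬ E x → uncurry M x ≈ 0#) →
                       (xs : Vec _ k) → ¬ All E xs → W xs ≈ 0#
    walkProduct-zero E? M-off []       ¬all = contradiction [] ¬all
    walkProduct-zero E? M-off (x ∷ xs) ¬all with E? x
    ... | yes ex = trans (*-congˡ (walkProduct-zero E? M-off xs (¬all ∘ (ex ∷_)))) (zeroʳ _)
    ... | no ¬ex = trans (*-congʳ (M-off x ¬ex)) (zeroˡ _)

    module _ (M-sym : ∀ i j → M i j ≈ M j i) where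

      walkProduct-swap : ∀ (xs : Vec _ k) → W (Vec.map swap xs) ≈ W xs
      walkProduct-swap []             = refl
      walkProduct-swap ((i , j) ∷ xs) = *-cong (M-sym j i) (walkProduct-swap xs)

      -- Rotation permutes the factors; reversal also exchanges the two indices of each, which the
      -- symmetry of M absorbs.
      cycleProduct-invariant : ∀ {c d : Vec (Fin n) (suc k)} → SameCycle c d → W (steps d) ≈ W (steps c)
      cycleProduct-invariant {c = c} = orbit-closed {P = P} P-rotate
        (reverse-closed {P = P} P-rotate (λ d eq → trans (reflexive (≡.cong W (steps-reverse-rotate d)))
          (trans (walkProduct-reverse (Vec.map swap (steps d))) (trans (walkProduct-swap (steps d)) eq)))) refl
        where
        P : Vec (Fin n) m → Set ℓ
        P d = W (steps d) ≈ W (steps c)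
        P-rotate : ∀ (d : Vec (Fin n) m) → P d → P (rotate d)
        P-rotate d eq = trans (reflexive (≡.cong W (steps-rotate d))) (trans (walkProduct-rotate (steps d)) eq)

      listSum-cycleSequences : ∀ (G : SimpleGraph n) k →
        Σ (cycleSequences G (3 ℕ.+ k)) (W ∘ steps) ≈ ((3 ℕ.+ k) ℕ.+ (3 ℕ.+ k)) · Σ (cycles G (3 ℕ.+ k)) (W ∘ steps)
      listSum-cycleSequences G k = begin
        Σ (cycleSequences G (3 ℕ.+ k)) (W ∘ steps)
          ≈⟨ listSum-↭ (W ∘ steps) (cycleSequences-↭ G k) ⟩
        Σ (concatMap dihedralOrbit (cycles G (3 ℕ.+ k))) (W ∘ steps)
          ≈⟨ listSum-concatMap dihedralOrbit (cycles G (3 ℕ.+ k)) (W ∘ steps) ⟩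
        Σ (cycles G (3 ℕ.+ k)) (λ d → Σ (dihedralOrbit d) (W ∘ steps))
          ≈⟨ listSum-cong K (cycles G (3 ℕ.+ k)) (λ d → trans
               (listSum-const {xs = dihedralOrbit d} (ListAll.tabulate cycleProduct-invariant))
               (reflexive (≡.cong (_· W (steps d)) (length-orbit d)))) ⟩
        Σ (cycles G (3 ℕ.+ k)) (λ d → ((3 ℕ.+ k) ℕ.+ (3 ℕ.+ k)) · W (steps d))
          ≈⟨ listSum-· ((3 ℕ.+ k) ℕ.+ (3 ℕ.+ k)) (cycles G (3 ℕ.+ k)) (W ∘ steps) ⟩
        ((3 ℕ.+ k) ℕ.+ (3 ℕ.+ k)) · Σ (cycles G (3 ℕ.+ k)) (W ∘ steps) ∎

  private
    module Sq n = CommutativeRing (squarefreeRing K n)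

  -- XM in the squarefree algebra.
  variableMatrix : Matrix rawRing n → Matrix (Sq.rawRing n) n
  variableMatrix {n} M i j = Sq._*_ n (gen K i) (scalar K n (M i j))

  module _ (M : Matrix rawRing n) where
    private
      module S = Sq n
      module H = IsHom (scalar-isHom K n)
      Q = variableMatrix M

    -- Row i of XM carries xᵢ, so a walk collects one variable for the source of each step. Sources
    -- and targets are kept independent because `steps` itself is not recursive in c.
    walkProduct-variableMatrix : ∀ (c d : Vec (Fin n) k) →
      walkProduct (squarefreeRing K n) Q (zip c d) S.≈ scalar K n (walkProduct K M (zip c d)) S.* monomial K c
    walkProduct-variableMatrix []       []       = S.sym (S.trans (S.*-congʳ H.1#-homo) (S.*-identityˡ _))
    walkProduct-variableMatrix (i ∷ c) (j ∷ d) = S.trans (S.*-congˡ (walkProduct-variableMatrix c d))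
      (S.trans (rearrange (gen K i) (scalar K n (M i j)) _ _) (S.*-congʳ (S.sym (H.*-homo _ _))))
      where
      rearrange : ∀ x m w y → (x S.* m) S.* (w S.* y) S.≈ (m S.* w) S.* (x S.* y)
      rearrange x m w y = S.trans (S.*-congʳ (S.*-comm x m)) (interchange m x w y)
        where open CommutativeSemigroupProperties S.*-commutativeSemigroup using (interchange)

    total-trace : ∀ k → total K n (trace (squarefreeRing K n) Q (suc k)) ≈
                  Σ (vecsOver (allFin n) (suc k)) (λ c → walkProduct K M (steps c) * total K n (monomial K c))
    total-trace k = begin
      total K n (trace (squarefreeRing K n) Q (suc k))
        ≈⟨ total-cong K n (trace-closed-walks (squarefreeRing K n) Q k) ⟩
      total K n (listSum S.rawRing (vecsOver (allFin n) (suc k)) (walkProduct (squarefreeRing K n) Q ∘ steps))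
        ≈⟨ total-listSum K n (vecsOver (allFin n) (suc k)) (walkProduct (squarefreeRing K n) Q ∘ steps) ⟩
      Σ (vecsOver (allFin n) (suc k)) (total K n ∘ walkProduct (squarefreeRing K n) Q ∘ steps)
        ≈⟨ listSum-cong K (vecsOver (allFin n) (suc k)) (λ c → trans
             (total-cong K n (walkProduct-variableMatrix c (rotate c)))
             (total-scalar-* K n (walkProduct K M (steps c)) (monomial K c))) ⟩
      Σ (vecsOver (allFin n) (suc k)) (λ c → walkProduct K M (steps c) * total K n (monomial K c)) ∎

    module _ (G : SimpleGraph n) (M-sym : ∀ i j → M i j ≈ M j i)
             (M-off : ∀ x → ¬ uncurry (SimpleGraph._~_ G) x → uncurry M x ≈ 0#) where
      open SimpleGraph G

      M-diagonal : ∀ i → M i i ≈ 0#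
      M-diagonal i = M-off (i , i) (~-irrefl ≡.refl)

      total-trace-1 : total K n (trace (squarefreeRing K n) Q 1) ≈ 0#
      total-trace-1 = trans (total-trace 0) (listSum-zero (vecsOver (allFin n) 1) _
        (λ { (i ∷ []) → trans (*-congʳ (trans (*-congʳ (M-diagonal i)) (zeroˡ _))) (zeroˡ _) }))

      -- Among the conditions in `IsCycle`, the length bound holds outright, a repeated vertex kills
      -- the monomial, and a step that is not an edge kills the weight.
      total-trace-cycles : ∀ k →
        total K n (trace (squarefreeRing K n) Q (3 ℕ.+ k)) ≈ ((3 ℕ.+ k) ℕ.+ (3 ℕ.+ k)) ·
          Σ (cycles G (3 ℕ.+ k)) (walkProduct K M ∘ steps)
      total-trace-cycles k = trans (total-trace (2 ℕ.+ k)) (trans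
        (listSum-filter (isCycle? G) (vecsOver (allFin n) (3 ℕ.+ k)) on off)
        (listSum-cycleSequences M M-sym G k))
        where
        on : ∀ c → IsCycle G c → walkProduct K M (steps c) * total K n (monomial K c) ≈ walkProduct K M (steps c)
        on c (_ , c! , _) = trans (*-congˡ (total-monomial-unique K c!)) (*-identityʳ _)
        off : ∀ c → ¬ IsCycle G c → walkProduct K M (steps c) * total K n (monomial K c) ≈ 0#
        off c ¬cycle with AllPairs.allPairs? (λ i j → ¬? (i Fin.≟ j)) c
        ... | no ¬c! = trans (*-congˡ (trans (total-cong K n (monomial-repeated K c ¬c!)) (total-0 K n))) (zeroʳ _)
        ... | yes c! = trans (*-congʳ (walkProduct-zero M (uncurry _~?_) M-off (steps c)
                         (λ c~ → ¬cycle (s≤s (s≤s (s≤s z≤n)) , c! , c~)))) (zeroˡ _)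

      -- Closed walks of length 2 are ordered pairs of vertices. Sorting them by i < j and j < i
      -- gives the sum over edges twice, and the diagonal contributes nothing.
      total-trace-edges : (h : Fin n × Fin n → Carrier) → (∀ {i j} → i ~ j → M i j * M i j ≈ h (i , j)) →
                          total K n (trace (squarefreeRing K n) Q 2) ≈ Σ (edges G) h + Σ (edges G) h
      total-trace-edges h h-edge = begin
        total K n (trace (squarefreeRing K n) Q 2)
          ≈⟨ total-trace 1 ⟩
        Σ (vecsOver (allFin n) 2) g
          ≈⟨ listSum-cartesianProductWith K _∷_ (allFin n) (vecsOver (allFin n) 1) g ⟩
        Σ (allFin n) (λ i → Σ (vecsOver (allFin n) 1) (g ∘ (i ∷_)))
          ≈⟨ listSum-allFin K n (λ i → Σ (vecsOver (allFin n) 1) (g ∘ (i ∷_))) ⟩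
        sum (λ i → Σ (vecsOver (allFin n) 1) (g ∘ (i ∷_)))
          ≈⟨ sum-cong-≋ (λ i → trans
               (listSum-cartesianProductWith K _∷_ (allFin n) ([] ∷ []) (g ∘ (i ∷_)))
               (trans (listSum-allFin K n (λ j → g (i ∷ j ∷ []) + 0#)) (trans
                 (sum-cong-≋ (λ j → trans (+-identityʳ _) (split i j)))
                 (∑-distrib-+ (e i) (λ j → e j i))))) ⟩
        sum (λ i → sum (e i) + sum (λ j → e j i))
          ≈⟨ ∑-distrib-+ (λ i → sum (e i)) (λ i → sum (λ j → e j i)) ⟩
        sum (λ i → sum (e i)) + sum (λ i → sum (λ j → e j i))
          ≈⟨ +-congˡ (∑-comm (λ i j → e j i)) ⟩
        sum (λ i → sum (e i)) + sum (λ i → sum (e i))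
          ≈⟨ +-cong edge-sum edge-sum ⟩
        Σ (edges G) h + Σ (edges G) h ∎
        where
        open SemiringSum semiring using (∑-distrib-+)
        g : Vec (Fin n) 2 → Carrier
        g c = walkProduct K M (steps c) * total K n (monomial K c)
        restrict : ∀ {P : Set} → Dec P → Carrier → Carrier
        restrict (yes _) a = a
        restrict (no _)  a = 0#
        e : Fin n → Fin n → Carrier
        e i j = restrict (i Fin.<? j) (M i j * M i j)
        edge-sum : sum (λ i → sum (e i)) ≈ Σ (edges G) h
        edge-sum = trans (sym (listSum-pairs e)) (listSum-filter _ (cartesianProduct (allFin n) (allFin n)) on off)
          where
          on : ∀ x → uncurry Fin._<_ x × uncurry _~_ x → uncurry e x ≈ h x
          on (i , j) (i<j , i~j) with i Fin.<? j
          ... | yes _  = h-edge i~j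
          ... | no i≮j = contradiction i<j i≮j
          off : ∀ x → ¬ (uncurry Fin._<_ x × uncurry _~_ x) → uncurry e x ≈ 0#
          off (i , j) ¬edge with i Fin.<? j
          ... | yes i<j = trans (*-congʳ (M-off (i , j) (¬edge ∘ (i<j ,_)))) (zeroˡ _)
          ... | no _    = refl
        g-distinct : ∀ i j → i ≢ j → g (i ∷ j ∷ []) ≈ M i j * M i j
        g-distinct i j i≢j = trans
          (*-cong (*-congˡ (trans (*-identityʳ _) (M-sym j i))) (total-monomial-unique K ((i≢j ∷ []) ∷ [] ∷ [])))
          (*-identityʳ _)
        split : ∀ i j → g (i ∷ j ∷ []) ≈ e i j + e j i
        split i j with i Fin.<? j | j Fin.<? i
        ... | yes i<j | yes j<i = contradiction j<i (Fin.<-asym i<j)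
        ... | yes i<j | no _    = trans (g-distinct i j (Fin.<⇒≢ i<j)) (sym (+-identityʳ _))
        ... | no _    | yes j<i = trans (g-distinct i j (Fin.<⇒≢ j<i ∘ ≡.sym))
                                    (trans (*-cong (M-sym i j) (M-sym i j)) (sym (+-identityˡ _)))
        ... | no i≮j  | no j≮i  = trans (*-congʳ (trans (*-congʳ M-ij) (zeroˡ _))) (trans (zeroˡ _) (sym (+-identityˡ _)))
          where
          M-ij : M i j ≈ 0#
          M-ij = trans (reflexive (≡.cong (M i) (≡.sym (Fin.≤-antisym (ℕ.≮⇒≥ j≮i) (ℕ.≮⇒≥ i≮j))))) (M-diagonal i)

-- Reduction of det(I - tXM)

module _ (R : RawRing c ℓ) (K : CommutativeRing c′ ℓ′) {f : ∣ R ∣ → CommutativeRing.Carrier K}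
         (f-isHom : IsHom R (CommutativeRing.rawRing K) f) {n : ℕ} (M : Matrix R n) where
  private
    Rₓ = R [X^ n ]
    S = squarefreeRing K n
    module RT = RawRing (Rₓ ⟦t⟧)
    module S = CommutativeRing S
    module T where
      open CommutativeRing (seriesRing S) public
      open SemiringSum (CommutativeRing.semiring (seriesRing S)) public using (sum; sum-cong-≋)
    h : RT.Carrier → T.Carrier
    h = reduce K R f-isHom n ∘_
    h-isHom : IsHom (Rₓ ⟦t⟧) T.rawRing h
    h-isHom = series-isHom Rₓ S (reduce-isHom K R f-isHom n)
    module H = IsHom h-isHom
    Q = variableMatrix K (λ i j → f (M i j))

    h-const : ∀ {a b} → reduce K R f-isHom n a S.≈ b → h (constₜ Rₓ a) T.≈ constₜ S.rawRing b
    h-const eq zero    = eq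
    h-const eq (suc k) = H.0#-homo (suc k)

    h-t : h (t Rₓ) T.≈ t S.rawRing
    h-t 0             = H.0#-homo 0
    h-t 1             = IsHom.1#-homo (reduce-isHom K R f-isHom n)
    h-t (suc (suc k)) = H.0#-homo (suc k)

    h-diag : ∀ (d : Fin n → RT.Carrier) (e : Fin n → T.Carrier) → (∀ i → h (d i) T.≈ e i) →
             ∀ i j → h (diag (Rₓ ⟦t⟧) d i j) T.≈ diag T.rawRing e i j
    h-diag d e eq i j with i Fin.≟ j
    ... | yes _ = eq i
    ... | no _  = H.0#-homo

    X⊗M : Matrix (Rₓ ⟦t⟧) n
    X⊗M = _⊗_ (Rₓ ⟦t⟧) (diag (Rₓ ⟦t⟧) (λ i → constₜ Rₓ (var R i))) (λ i j → constₜ Rₓ (const R n (M i j)))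

    h-X⊗M : ∀ i j → h (X⊗M i j) T.≈ constₜ S.rawRing (Q i j)
    h-X⊗M i j = T.trans (sum-homo (Rₓ ⟦t⟧) (seriesRing S) h-isHom (λ l → X i l RT.* M′ l j))
      (T.trans (T.sum-cong-≋ (λ l → T.trans (H.*-homo (X i l) (M′ l j))
                 (T.*-cong {h (X i l)} {X′ i l} {h (M′ l j)} {M″ l j} (h-diag _ _ (λ i → h-const (reduce-var K R f-isHom i)) i l)
                           (h-const (reduce-const K R f-isHom n (M l j))))))
      (T.trans (sum-single (seriesRing S) i (λ l → X′ i l T.* M″ l j)
                 (λ l l≢i → T.trans (T.*-congʳ {M″ l j} (off l l≢i)) (T.zeroˡ (M″ l j))))
      (T.trans (T.*-congʳ {M″ i j} on)
               (λ k → S.trans (constₜ-* S (gen K i) (M″ i j) k) (scale k)))))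
      where
      X M′ : Matrix (Rₓ ⟦t⟧) n
      X = diag (Rₓ ⟦t⟧) (λ i → constₜ Rₓ (var R i))
      M′ i j = constₜ Rₓ (const R n (M i j))
      X′ M″ : Matrix T.rawRing n
      X′ = diag T.rawRing (λ i → constₜ S.rawRing (gen K i))
      M″ i j = constₜ S.rawRing (scalar K n (f (M i j)))
      on : X′ i i T.≈ constₜ S.rawRing (gen K i)
      on with i Fin.≟ i
      ... | yes _  = T.refl {constₜ S.rawRing (gen K i)}
      ... | no i≢i = contradiction ≡.refl i≢i
      off : ∀ l → l ≢ i → X′ i l T.≈ T.0#
      off l l≢i with i Fin.≟ l
      ... | yes i≡l = contradiction (≡.sym i≡l) l≢i
      ... | no _    = T.refl {T.0#}
      scale : ∀ k → gen K i S.* M″ i j k S.≈ constₜ S.rawRing (Q i j) k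
      scale zero    = S.refl
      scale (suc k) = S.zeroʳ _

  -- A determinant commutes with homomorphisms, so the reduction can be made entry by entry; the
  -- diagonal factor X leaves the single term xᵢ mᵢⱼ.
  reduce-det : ∀ k → reduce K R f-isHom n (det[I-tXM] R M k) S.≈ det T.rawRing (I-tQ S Q) k
  reduce-det = T.trans (det-homo (Rₓ ⟦t⟧) (seriesRing S) h-isHom (λ i j → identity (Rₓ ⟦t⟧) i j RT.+ RT.- (t Rₓ RT.* X⊗M i j)))
    (det-cong (seriesRing S) entry)
    where
    entry : ∀ i j → h (identity (Rₓ ⟦t⟧) i j RT.+ RT.- (t Rₓ RT.* X⊗M i j)) T.≈ I-tQ S Q i j
    entry i j = T.trans (H.+-homo (identity (Rₓ ⟦t⟧) i j) (RT.- (t Rₓ RT.* X⊗M i j)))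
      (T.+-cong (h-diag _ _ (λ _ → H.1#-homo) i j)
        (T.trans (H.-‿homo (t Rₓ RT.* X⊗M i j)) (T.-‿cong
          (T.trans (H.*-homo (t Rₓ) (X⊗M i j)) (T.*-cong {h (t Rₓ)} {t S.rawRing} {h (X⊗M i j)} h-t (h-X⊗M i j))))))

-- Polynomials in w and r

id-isHom : (R : CommutativeRing c ℓ) → IsHom (CommutativeRing.rawRing R) (CommutativeRing.rawRing R) id
id-isHom R = record
  { cong = id ; +-homo = λ _ _ → refl ; *-homo = λ _ _ → refl ; -‿homo = λ _ → refl ; 0#-homo = refl ; 1#-homo = refl }
  where open CommutativeRing R

∘-isHom : {R : RawRing c ℓ} {S : RawRing c′ ℓ′} (T : CommutativeRing c″ ℓ″)
          {g : ∣ S ∣ → CommutativeRing.Carrier T} {f : ∣ R ∣ → ∣ S ∣} →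
          IsHom S (CommutativeRing.rawRing T) g → IsHom R S f → IsHom R (CommutativeRing.rawRing T) (g ∘ f)
∘-isHom T G F = record
  { cong    = G.cong ∘ F.cong
  ; +-homo  = λ x y → trans (G.cong (F.+-homo x y)) (G.+-homo _ _)
  ; *-homo  = λ x y → trans (G.cong (F.*-homo x y)) (G.*-homo _ _)
  ; -‿homo  = λ x → trans (G.cong (F.-‿homo x)) (G.-‿homo _)
  ; 0#-homo = trans (G.cong F.0#-homo) G.0#-homo
  ; 1#-homo = trans (G.cong F.1#-homo) G.1#-homo
  }
  where
  open CommutativeRing T
  module F = IsHom F
  module G = IsHom G

constₜ-isHom : (R : CommutativeRing c ℓ) →
               IsHom (CommutativeRing.rawRing R) (CommutativeRing.rawRing R ⟦t⟧) (constₜ (CommutativeRing.rawRing R))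
constₜ-isHom R = record
  { cong    = λ { p zero → p ; p (suc _) → refl }
  ; +-homo  = λ { _ _ zero → refl ; _ _ (suc _) → sym (+-identityˡ _) }
  ; *-homo  = λ { a b zero → sym (constₜ-* R a (constₜ rawRing b) 0)
                ; a b (suc k) → sym (trans (constₜ-* R a (constₜ rawRing b) (suc k)) (zeroʳ _)) }
  ; -‿homo  = λ { _ zero → refl ; _ (suc _) → sym -0#≈0# }
  ; 0#-homo = λ { zero → refl ; (suc _) → refl }
  ; 1#-homo = λ { zero → refl ; (suc _) → refl }
  }
  where
  open CommutativeRing R hiding (zero)
  open RingProperties ring using (-0#≈0#)

-- Since `_/_` reduces fractions to lowest terms, the product is compared through unnormalised
-- fractions, where it is given by the usual formula.
/-*-/ : ∀ a b m n → (a / suc m) ℚ.* (b / suc n) ≡ fromℚᵘ (ℚᵘ.mkℚᵘ a m ℚᵘ.* ℚᵘ.mkℚᵘ b n)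
/-*-/ a b m n = ℚ.toℚᵘ-injective (ℚᵘ.≃-trans (ℚ.toℚᵘ-homo-* (a / suc m) (b / suc n))
  (ℚᵘ.≃-trans (ℚᵘ.*-cong (ℚ.toℚᵘ-fromℚᵘ (ℚᵘ.mkℚᵘ a m)) (ℚ.toℚᵘ-fromℚᵘ (ℚᵘ.mkℚᵘ b n)))
              (ℚᵘ.≃-sym (ℚ.toℚᵘ-fromℚᵘ _))))

/-+-/ : ∀ a b m n → (a / suc m) ℚ.+ (b / suc n) ≡ fromℚᵘ (ℚᵘ.mkℚᵘ a m ℚᵘ.+ ℚᵘ.mkℚᵘ b n)
/-+-/ a b m n = ℚ.toℚᵘ-injective (ℚᵘ.≃-trans (ℚ.toℚᵘ-homo-+ (a / suc m) (b / suc n))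
  (ℚᵘ.≃-trans (ℚᵘ.+-cong (ℚ.toℚᵘ-fromℚᵘ (ℚᵘ.mkℚᵘ a m)) (ℚ.toℚᵘ-fromℚᵘ (ℚᵘ.mkℚᵘ b n)))
              (ℚᵘ.≃-sym (ℚ.toℚᵘ-fromℚᵘ _))))

/1-isHom : IsHom ℤ.+-*-rawRing ℚ.+-*-rawRing (_/ 1)
/1-isHom = record
  { cong    = ≡.cong (_/ 1)
  ; +-homo  = λ a b → ≡.sym (≡.trans (/-+-/ a b 0 0) (ℚ.fromℚᵘ-cong {ℚᵘ.mkℚᵘ a 0 ℚᵘ.+ ℚᵘ.mkℚᵘ b 0} {ℚᵘ.mkℚᵘ (a ℤ.+ b) 0}
                (ℚᵘ.*≡*
                (≡.cong (ℤ._* 1ℤ) (≡.cong₂ ℤ._+_ (ℤ.*-identityʳ a) (ℤ.*-identityʳ b))))))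
  ; *-homo  = λ a b → ≡.sym (/-*-/ a b 0 0)
  ; -‿homo  = neg
  ; 0#-homo = ≡.refl
  ; 1#-homo = ≡.refl
  }
  where
  neg : ∀ a → (ℤ.- a) / 1 ≡ ℚ.- (a / 1)
  neg (+ zero)      = ≡.refl
  neg (+ suc n)     = ≡.refl
  -- A negative numerator is divided by negating the positive quotient, so the right-hand side is a
  -- double negation.
  neg (ℤ.-[1+ n ]) = ≡.sym (AbelianGroupProperties.⁻¹-involutive (CommutativeRing.+-abelianGroup ℚ.+-*-commutativeRing) _)

/-*-denominator : ∀ z j → (z / suc j) ℚ.* (+ suc j / 1) ≡ z / 1
/-*-denominator z j = ≡.trans (/-*-/ z (+ suc j) j 0) (ℚ.fromℚᵘ-cong {ℚᵘ.mkℚᵘ z j ℚᵘ.* ℚᵘ.mkℚᵘ (+ suc j) 0} {ℚᵘ.mkℚᵘ z 0} (ℚᵘ.*≡*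
  (≡.trans (ℤ.*-identityʳ (z ℤ.* + suc j)) (≡.cong (λ d → z ℤ.* + d) (≡.sym (ℕ.*-identityʳ (suc j)))))))

-- Algebras over ℚ and division by positive integers

module _ (A : CommutativeRing c ℓ) {r : ℚ → CommutativeRing.Carrier A}
         (r-isHom : IsHom ℚ.+-*-rawRing (CommutativeRing.rawRing A) r) where
  open CommutativeRing A hiding (zero)
  open SemiringMult semiring using (×-congʳ) renaming (_×_ to _·_)
  open SemiringExp semiring using (_^_)
  open RingProperties ring using (-1*x≈-x)
  open AbelianGroupProperties +-abelianGroup using (⁻¹-involutive)
  open SetoidReasoning setoid
  private
    module Z = IsHom (∘-isHom A r-isHom /1-isHom)

  algebra-· : ∀ m a → r (+ m / 1) * a ≈ m · a
  algebra-· zero    a = trans (*-congʳ Z.0#-homo) (zeroˡ a)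
  algebra-· (suc m) a = begin
    r ((+ 1 ℤ.+ + m) / 1) * a              ≈⟨ *-congʳ (Z.+-homo (+ 1) (+ m)) ⟩
    (r (+ 1 / 1) + r (+ m / 1)) * a        ≈⟨ distribʳ _ _ _ ⟩
    r (+ 1 / 1) * a + r (+ m / 1) * a      ≈⟨ +-cong (trans (*-congʳ Z.1#-homo) (*-identityˡ a)) (algebra-· m a) ⟩
    a + m · a                              ∎

  algebra-/ : ∀ z j a → r (z / suc j) * (suc j · a) ≈ r (z / 1) * a
  algebra-/ z j a = begin
    r (z / suc j) * (suc j · a)             ≈⟨ *-congˡ (algebra-· (suc j) a) ⟨
    r (z / suc j) * (r (+ suc j / 1) * a)   ≈⟨ *-assoc _ _ _ ⟨
    r (z / suc j) * r (+ suc j / 1) * a     ≈⟨ *-congʳ (IsHom.*-homo r-isHom _ _) ⟨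
    r ((z / suc j) ℚ.* (+ suc j / 1)) * a   ≈⟨ *-congʳ (reflexive (≡.cong r (/-*-denominator z j))) ⟩
    r (z / 1) * a                           ∎

  algebra-sign : ∀ j → r ((-1ℤ ℤ.^ j) / 1) ≈ (- 1#) ^ j
  algebra-sign zero    = Z.1#-homo
  algebra-sign (suc j) = trans (Z.*-homo -1ℤ (-1ℤ ℤ.^ j))
    (*-cong (trans (Z.-‿homo 1ℤ) (-‿cong Z.1#-homo)) (algebra-sign j))

  -- The index j starts at 0, so it names the term u to the power j + 1, whose sign has exponent j +
  -- 2; two sign changes cancel.
  log-coefficient : ∀ j a → r ((-1ℤ ℤ.^ suc (suc j)) / suc j) * (suc j · a) ≈ (- 1#) ^ j * a
  log-coefficient j a = trans (algebra-/ (-1ℤ ℤ.^ suc (suc j)) j a) (*-congʳ (trans (algebra-sign (suc (suc j)))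
    (trans (-1*x≈-x _) (trans (-‿cong (-1*x≈-x _)) (⁻¹-involutive _)))))

  -- The image of 1 / (j + 1) undoes the multiplication, which turns identities for k times
  -- coefficient k into identities of coefficients.
  ·-cancel : ∀ j {x y} → suc j · x ≈ suc j · y → x ≈ y
  ·-cancel j {x} {y} eq = begin
    x                              ≈⟨ recover x ⟨
    r (1ℤ / suc j) * (suc j · x)   ≈⟨ *-congˡ eq ⟩
    r (1ℤ / suc j) * (suc j · y)   ≈⟨ recover y ⟩
    y                              ∎
    where
    recover : ∀ x → r (1ℤ / suc j) * (suc j · x) ≈ x
    recover x = trans (algebra-/ 1ℤ j x) (trans (*-congʳ Z.1#-homo) (*-identityˡ x))

-- ℚ⟦w⟧⟦r⟧. Equality in ℚ[w,r] is coefficientwise, so it can be tested here, and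
-- no ring axioms for coefficient lists are needed.
K : CommutativeRing _ _
K = seriesRing (seriesRing ℚ.+-*-commutativeRing)

private
  module K where
    open CommutativeRing K public
    open SemiringMult semiring public using (×-congʳ) renaming (_×_ to _·_)

ℚ→K : ℚ → K.Carrier
ℚ→K q = constₜ (ℚ.+-*-rawRing ⟦t⟧) (constₜ ℚ.+-*-rawRing q)

ℚ→K-isHom : IsHom ℚ.+-*-rawRing K.rawRing ℚ→K
ℚ→K-isHom = ∘-isHom K (constₜ-isHom (seriesRing ℚ.+-*-commutativeRing)) (constₜ-isHom ℚ.+-*-commutativeRing)

ℚ[w,r]→K : ∣ ℚ[w,r] ∣ → K.Carrier
ℚ[w,r]→K p i j = coeff ℚ.+-*-rawRing (coeff (Poly ℚ.+-*-rawRing) p i) j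

ℚ[w,r]→K-isHom : IsHom ℚ[w,r] K.rawRing ℚ[w,r]→K
ℚ[w,r]→K-isHom = poly-isHom (Poly ℚ.+-*-rawRing) (seriesRing ℚ.+-*-commutativeRing)
  (poly-isHom ℚ.+-*-rawRing ℚ.+-*-commutativeRing (id-isHom ℚ.+-*-commutativeRing))

ℤ[w,r]→K : ∣ ℤ[w,r] ∣ → K.Carrier
ℤ[w,r]→K p i j = coeff ℤ.+-*-rawRing (coeff (Poly ℤ.+-*-rawRing) p i) j / 1

ℤ[w,r]→K-isHom : IsHom ℤ[w,r] K.rawRing ℤ[w,r]→K
ℤ[w,r]→K-isHom = poly-isHom (Poly ℤ.+-*-rawRing) (seriesRing ℚ.+-*-commutativeRing)
  (poly-isHom ℤ.+-*-rawRing ℚ.+-*-commutativeRing /1-isHom)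

private
  module Φ = IsHom ℤ[w,r]→K-isHom

ι-compatible : ∀ p → ℚ[w,r]→K (ι p) K.≈ ℤ[w,r]→K p
ι-compatible []      i       j = ≡.refl
ι-compatible (p ∷ ps) zero    j = inner p j
  where
  inner : ∀ p j → coeff ℚ.+-*-rawRing (mapCoeffs ℤ.+-*-rawRing ℚ.+-*-rawRing 1 (_/ 1) p) j ≡ coeff ℤ.+-*-rawRing p j / 1
  inner []      j       = ≡.refl
  inner (a ∷ p) zero    = ≡.refl
  inner (a ∷ p) (suc j) = inner p j
ι-compatible (p ∷ ps) (suc i) j = ι-compatible ps i j

-- Comparison of the two series

module _ {n : ℕ} {G : SimpleGraph n} (W : EdgeWeights ℤ[w,r] G) where
  open SimpleGraph G
  open EdgeWeights W
  private
    S = squarefreeRing K n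
    module S where
      open CommutativeRing S public
      open SemiringMult semiring public using () renaming (_×_ to _·_)

  M : Matrix K.rawRing n
  M i j = ℤ[w,r]→K (adjacency ℤ[w,r] W i j)

  M-edge : ∀ {i j} → i ~ j → M i j K.≈ ℤ[w,r]→K (wg i j)
  M-edge {i} {j} i~j with i ~? j
  ... | yes _  = K.refl {ℤ[w,r]→K (wg i j)}
  ... | no i≁j = contradiction i~j i≁j

  M-off : ∀ x → ¬ uncurry _~_ x → uncurry M x K.≈ K.0#
  M-off (i , j) i≁j with i ~? j
  ... | yes i~j = contradiction i~j i≁j
  ... | no _    = Φ.0#-homo

  M-sym : ∀ i j → M i j K.≈ M j i
  M-sym i j with i ~? j | j ~? i
  ... | yes i~j | yes _   = Φ.cong {wg i j} {wg j i} (wg-sym i~j)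
  ... | yes i~j | no j≁i  = contradiction (~-sym i~j) j≁i
  ... | no i≁j  | yes j~i = contradiction (~-sym j~i) i≁j
  ... | no _    | no _    = K.refl {ℤ[w,r]→K []}

  -- `cycleWeight` multiplies values of `wg`, walks multiply adjacency entries; along edges the two
  -- coincide.
  walkProduct-edges : ∀ (xs : Vec (Fin n × Fin n) k) → All (uncurry _~_) xs →
                      walkProduct K M xs K.≈ ℤ[w,r]→K (Vec.foldr′ (RawRing._*_ ℤ[w,r]) (RawRing.1# ℤ[w,r]) (Vec.map (uncurry wg) xs))
  walkProduct-edges []             []           = K.sym {ℤ[w,r]→K (RawRing.1# ℤ[w,r])} {K.1#} Φ.1#-homo
  walkProduct-edges ((i , j) ∷ xs) (i~j ∷ xs~) = K.trans
    (K.*-cong {M i j} {ℤ[w,r]→K (wg i j)} {walkProduct K M xs} (M-edge i~j) (walkProduct-edges xs xs~))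
    (K.sym (Φ.*-homo (wg i j) (Vec.foldr′ (RawRing._*_ ℤ[w,r]) (RawRing.1# ℤ[w,r]) (Vec.map (uncurry wg) xs))))

  Q : Matrix S.rawRing n
  Q = variableMatrix K M

  ℚ→S : ℚ → S.Carrier
  ℚ→S = scalar K n ∘ ℚ→K

  ℚ→S-isHom : IsHom ℚ.+-*-rawRing S.rawRing ℚ→S
  ℚ→S-isHom = ∘-isHom S (scalar-isHom K n) ℚ→K-isHom

  reduceℚ = reduce K ℚ[w,r] ℚ[w,r]→K-isHom n

  structureMap : ℚ → ∣ ℚ[w,r] [X^ n ] ∣
  structureMap q = const ℚ[w,r] n (const ℚ.+-*-rawRing 2 q)

  structureMap-reduce : ∀ q → reduceℚ (structureMap q) S.≈ ℚ→S q
  structureMap-reduce q = S.trans (reduce-const K ℚ[w,r] ℚ[w,r]→K-isHom n (const ℚ.+-*-rawRing 2 q))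
    (IsHom.cong (scalar-isHom K n) λ { zero zero → ≡.refl ; zero (suc _) → ≡.refl ; (suc _) zero → ≡.refl ; (suc _) (suc _) → ≡.refl })

  negLog : ℕ → S.Carrier
  negLog k = S.- log S.rawRing (reduceℚ ∘ structureMap) (det (S.rawRing ⟦t⟧) (I-tQ S Q)) k

  -- The layers of the definition are carried through the reduction one at a time, from the outside
  -- in: `sq`, negation, `log`, the inclusion of coefficients and the determinant.
  sqNegLogDet-total : ∀ k → ℚ[w,r]→K (sqNegLogDet W k) K.≈ total K n (negLog k)
  sqNegLogDet-total k = K.trans (sq-reduce K ℚ[w,r] ℚ[w,r]→K-isHom n (RawRing.-_ (ℚ[w,r] [X^ n ]) (L k)))
    (total-cong K n (S.trans (IsHom.-‿homo reduce-hom (L k)) (S.-‿cong (S.trans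
      (log-homo (ℚ[w,r] [X^ n ]) S reduce-hom structureMap F k)
      (log-cong S (reduceℚ ∘ structureMap) {reduceℚ ∘ F} {det (S.rawRing ⟦t⟧) (I-tQ S Q)} (λ k → S.trans
        (reduce-mapCoeffs K ℤ[w,r] ℚ[w,r] ℤ[w,r]→K-isHom ℚ[w,r]→K-isHom ι ι-compatible n
          (det[I-tXM] ℤ[w,r] (adjacency ℤ[w,r] W) k))
        (reduce-det ℤ[w,r] K ℤ[w,r]→K-isHom (adjacency ℤ[w,r] W) k)) k)))))
    where
    reduce-hom = reduce-isHom K ℚ[w,r] ℚ[w,r]→K-isHom n
    F : ∣ ℚ[w,r] [X^ n ] ⟦t⟧ ∣
    F = ιₓₜ {n} (det[I-tXM] ℤ[w,r] (adjacency ℤ[w,r] W))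
    L : ∣ ℚ[w,r] [X^ n ] ⟦t⟧ ∣
    L = logₓₜ {n} F

  total-· : ∀ k x → total K n (k S.· x) K.≈ k K.· total K n x
  total-· zero    x = total-0 K n
  total-· (suc k) x = K.trans (total-+ K n x (k S.· x)) (K.+-congˡ {total K n x} (total-· k x))

  ·-sqNegLogDet : ∀ k → k K.· ℚ[w,r]→K (sqNegLogDet W k) K.≈ total K n (trace S Q k)
  ·-sqNegLogDet k = K.trans (K.×-congʳ k {ℚ[w,r]→K (sqNegLogDet W k)} (sqNegLogDet-total k))
    (K.trans (K.sym (total-· k (negLog k)))
             (total-cong K n (neg-log-det S Q (reduceℚ ∘ structureMap)
               (λ j a → S.trans (S.*-congʳ (structureMap-reduce ((-1ℤ ℤ.^ suc (suc j)) / suc j))) (log-coefficient S ℚ→S-isHom j a)) k)))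

  -- The multiplicities agree: (k + 1) times 2 C for cycles of length k + 1 against 2 (k + 1)
  -- readings of each, and the factor 2 in degree 2 against the two readings of an edge.
  ·-edgeCycleSeries : ∀ k → suc k K.· ℤ[w,r]→K (edgeCycleSeries ℤ[w,r] W (suc k)) K.≈ total K n (trace S Q (suc k))
  ·-edgeCycleSeries 0 = K.trans (K.+-identityʳ (ℤ[w,r]→K [])) (K.trans Φ.0#-homo (K.sym (total-trace-1 K M G M-sym M-off)))
  ·-edgeCycleSeries 1 = K.trans
    (K.+-congˡ {E} (K.+-identityʳ E))
    (K.trans (K.+-cong {E} {E′} {E} {E′} E≈ E≈) (K.sym (total-trace-edges K M G M-sym M-off h (λ {i} {j} i~j →
      K.trans (K.*-cong {M i j} {ℤ[w,r]→K (wg i j)} {M i j} {ℤ[w,r]→K (wg i j)} (M-edge i~j) (M-edge i~j))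
              (K.sym (Φ.*-homo (wg i j) (wg i j)))))))
    where
    w² : Fin n × Fin n → ∣ ℤ[w,r] ∣
    w² (i , j) = RawRing._*_ ℤ[w,r] (wg i j) (wg i j)
    h : Fin n × Fin n → K.Carrier
    h = ℤ[w,r]→K ∘ w²
    E = ℤ[w,r]→K (listSum ℤ[w,r] (edges G) w²)
    E′ = listSum K.rawRing (edges G) h
    E≈ : E K.≈ E′
    E≈ = listSum-homo ℤ[w,r] K ℤ[w,r]→K-isHom (edges G) w²
  ·-edgeCycleSeries (suc (suc k)) = K.trans (K.×-congʳ k₊ {ℤ[w,r]→K (RawRing._*_ ℤ[w,r] 2# (cycleSum ℤ[w,r] W k₊))} twice)
    (K.trans (m-twice (listSum K.rawRing (cycles G k₊) (walkProduct K M ∘ steps)))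
             (K.sym (total-trace-cycles K M G M-sym M-off k)))
    where
    k₊ = 3 ℕ.+ k
    2# : ∣ ℤ[w,r] ∣
    2# = RawRing._+_ ℤ[w,r] (RawRing.1# ℤ[w,r]) (RawRing.1# ℤ[w,r])
    Cₖ = listSum K.rawRing (cycles G k₊) (walkProduct K M ∘ steps)
    cycleSum-walks : ℤ[w,r]→K (cycleSum ℤ[w,r] W k₊) K.≈ Cₖ
    cycleSum-walks = K.trans (listSum-homo ℤ[w,r] K ℤ[w,r]→K-isHom (cycles G k₊) (cycleWeight ℤ[w,r] W))
      (listSum-cong-All K {xs = cycles G k₊}
        (ListAll.map (λ {c} (_ , _ , c~) → K.sym (walkProduct-edges (steps c) c~)) (all-cycles-IsCycle G k₊)))
    twice : ℤ[w,r]→K (RawRing._*_ ℤ[w,r] 2# (cycleSum ℤ[w,r] W k₊)) K.≈ Cₖ K.+ Cₖ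
    twice = K.trans (Φ.*-homo 2# (cycleSum ℤ[w,r] W k₊))
      (K.trans (K.*-cong {ℤ[w,r]→K 2#} {K.1# K.+ K.1#} {ℤ[w,r]→K (cycleSum ℤ[w,r] W k₊)} {Cₖ}
                 (K.trans (Φ.+-homo (RawRing.1# ℤ[w,r]) (RawRing.1# ℤ[w,r]))
                   (K.+-cong {ℤ[w,r]→K (RawRing.1# ℤ[w,r])} {K.1#} {ℤ[w,r]→K (RawRing.1# ℤ[w,r])} {K.1#} Φ.1#-homo Φ.1#-homo))
                 cycleSum-walks)
      (K.trans (K.distribʳ Cₖ K.1# K.1#) (K.+-cong {K.1# K.* Cₖ} {Cₖ} {K.1# K.* Cₖ} {Cₖ} (K.*-identityˡ Cₖ) (K.*-identityˡ Cₖ))))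
    m-twice : ∀ x → k₊ K.· (x K.+ x) K.≈ (k₊ ℕ.+ k₊) K.· x
    m-twice x = K.trans (×-distrib-+ x x k₊) (K.sym (×-homo-+ x k₊ k₊))
      where
      open CommutativeMonoidMult K.+-commutativeMonoid using (×-distrib-+; ×-homo-+)

  sqNegLogDet≈edgeCycleSeries : ∀ k → ℚ[w,r]→K (sqNegLogDet W k) K.≈ ℤ[w,r]→K (edgeCycleSeries ℤ[w,r] W k)
  -- Cancelling the factor k says nothing in degree 0, but there the logarithm is an empty sum.
  sqNegLogDet≈edgeCycleSeries zero    = K.trans (sqNegLogDet-total 0)
    (K.trans (total-cong K n (RingProperties.-0#≈0# S.ring)) (K.trans (total-0 K n) (K.sym Φ.0#-homo)))
  sqNegLogDet≈edgeCycleSeries (suc k) = ·-cancel K ℚ→K-isHom k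
    {ℚ[w,r]→K (sqNegLogDet W (suc k))} {ℤ[w,r]→K (edgeCycleSeries ℤ[w,r] W (suc k))}
    (K.trans (·-sqNegLogDet (suc k)) (K.sym (·-edgeCycleSeries k)))

edgeCycleSeries-degree : ∀ {n} {G : SimpleGraph n} (W : EdgeWeights ℤ[w,r] G) → DegreeAtMost ℤ[w,r] n (edgeCycleSeries ℤ[w,r] W)
edgeCycleSeries-degree         W 1 _ _ _ = ≡.refl
-- With fewer than two vertices no pair satisfies i < j, and `edges G` computes to the empty list.
edgeCycleSeries-degree {zero}  W 2 _ _ _ = ≡.refl
edgeCycleSeries-degree {suc zero} {G} W 2 _ i j = ≡.refl
edgeCycleSeries-degree {suc (suc n)} W 2 (s≤s (s≤s ()))
edgeCycleSeries-degree {n} {G} W (suc (suc (suc k))) n<k i j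
  rewrite cycles-empty G (3 ℕ.+ k) n<k = helper i j
  where
  helper : ∀ i j → coeff ℤ.+-*-rawRing (coeff (Poly ℤ.+-*-rawRing)
    (RawRing._*_ ℤ[w,r] (RawRing._+_ ℤ[w,r] (RawRing.1# ℤ[w,r]) (RawRing.1# ℤ[w,r])) []) i) j ≡ ℤ.+ 0
  helper zero    j = ≡.refl
  helper (suc i) j = ≡.refl

theorem4p3 : (n : ℕ) (G : SimpleGraph n) (W : EdgeWeights ℤ[w,r] G) →
    RawRing._≈_ (ℚ[w,r] ⟦t⟧) (sqNegLogDet W) (ιₜ (edgeCycleSeries ℤ[w,r] W))
    × RawRing._≈_ ℚ[w,r] (sqNegLogDet W 1) (RawRing.0# ℚ[w,r])
    × DegreeAtMost ℤ[w,r] n (edgeCycleSeries ℤ[w,r] W)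
theorem4p3 n G W = equality , equality 1 , edgeCycleSeries-degree W
  where
  equality : ∀ k i j → ℚ[w,r]→K (sqNegLogDet W k) i j ≡ ℚ[w,r]→K (ι (edgeCycleSeries ℤ[w,r] W k)) i j
  equality k i j = ≡.trans (sqNegLogDet≈edgeCycleSeries W k i j) (≡.sym (ι-compatible (edgeCycleSeries ℤ[w,r] W k) i j))
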